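{- Consider the online assortment problem with inventory shocks and the Batched Inventory Balancing (BIB) algorithm, both defined in the context. Fix $n$ products with prices $r_i\ge 0$, usage durations $d_i$ and initial inventories $c_i$ ($i\in[n]$), and let $c_0=\min_{i\in[n]}c_i$ be the smallest initial inventory. Let $\Psi:[0,1]\to[0,1]$ be any monotone non-decreasing, concave and differentiable penalty function with $\Psi(0)=0$ and $\Psi(1)=1$, and let $\gamma\in[1,c_0]$ be any integer batch-size threshold. Then the competitive ratio of the BIB algorithm with penalty function $\Psi$ and threshold $\gamma$, against the clairvoyant optimum offline benchmark, is at least $$\Gamma(\Psi,\gamma)=\min\{\Gamma_1(\Psi,\gamma),\Gamma_2(\Psi,\gamma)\},$$ where $$\Gamma_1(\Psi,\gamma)=\min_{x\in[0,1-\frac1{c_0}]}\left\{\frac{1-x}{\frac1{c_0}+\left(1+\frac{\gamma}{c_0}\right)(1-\Psi(x))+\int_{x+\frac1{c_0}}^1\Psi(y)\,dy}\right\},$$ $$\Gamma_2(\Psi,\gamma)=\min_{x\in[0,1-\frac1{\gamma}]}\left\{\frac{1-x}{\frac1{\gamma}+1-\Psi(x)+\int_{x+\frac1{\gamma}}^1\Psi(y)\,dy}\right\}.$$ That is, for every horizon $T\ge1$ and every sequence of consumer choice models and exogenous shocks $\{\phi_t,\xi_{i,t}\}_{i\in[n],t\in[T]}$, the expected revenue of BIB is at least $\Gamma(\Psi,\gamma)$ times the expected revenue of the clairvoyant optimum offline benchmark.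
   Context: **Model.** There are $n$ products, indexed by $[n]=\{1,\dots,n\}$. Product $i$ has initial inventory $c_i\in\mathbb{Z}_{+}$ (positive integer), a deterministic usage duration $d_i$ (positive integer) and per-unit price $r_i\ge 0$. Time is discrete, $t\in[T]$. - Exogenous shocks: at the beginning of period $t$, $\xi_{i,t}\in\mathbb{Z}_{\ge0}$ new units of each product $i$ are added to the inventory (in addition to the initial inventory). - Consumers: consumer $t$ arrives at period $t$ with a choice model $\phi_t:\mathcal{S}\times[n]\to[0,1]$, where $\mathcal{S}\subseteq 2^{[n]}$ is the (nonempty) collection of feasible assortments; $\phi_t(S,i)$ is the probability that consumer $t$ chooses product $i$ when offered $S$ (so $\phi_t(S,i)=0$ for $i\notin S$ and $\sum_i\phi_t(S,i)\le1$; with the remaining probability she chooses nothing). - At period $t$, $\phi_t$ and $\{\xi_{i,t}\}_{i}$ are revealed; the platform, knowing the history, offers an assortment $S_t\in\mathcal{S}$ of products with available inventory. Consumer $t$ randomly (independently given the history) chooses a product $i_t\in S_t$ according to $\phi_t(S_t,\cdot)$, or nothing. If $i_t=i$ is chosen, revenue $r_i$ is collected, and one unit of $i$ leaves the inventory. - Endogenous shocks: a unit of product $i$ sold at period $t$ returns to the inventory at the beginning of period $t+d_i$. **Standing assumptions.** (1) Weak substitutability: $\phi_t(\emptyset,i)=0$, and $\phi_t(S,i)\ge\phi_t(S\cup\{j\},i)$ for all $t$, $i$, $j\neq i$ and $S\in\mathcal{S}$ (whenever $S\cup\{j\}\in\mathcal S$). (2) $\mathcal{S}$ is downward closed: $S\in\mathcal{S}$,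 $S'\subseteq S$ imply $S'\in\mathcal{S}$. (3) There is an exact oracle that, for any $t$ and any $\hat R\in\mathbb{R}_{+}^n$, returns an assortment in $\arg\max_{S\in\mathcal{S}}\sum_{i}\hat R_i\phi_t(S,i)$ having smallest cardinality among all maximizers. **Benchmark and competitive ratio.** The clairvoyant optimum offline benchmark is the maximum expected revenue over all (possibly adaptive) inventory-feasible policies that know the entire sequence $\{\phi_t,\xi_{i,t}\}_{i\in[n],t\in[T]}$ in advance, but not the realizations of the consumers' random choices. Denote it $\mathrm{OPT}[\{\phi_t,\xi_{i,t}\}]$. For fixed products $\{r_i,d_i,c_i\}$, the competitive ratio of an online algorithm $\mathcal A$ is $\inf_{T\ge1}\inf_{\{\phi_t,\xi_{i,t}\}}\mathrm{Rev}_{\mathcal A}[\{\phi_t,\xi_{i,t}\}]/\mathrm{OPT}[\{\phi_t,\xi_{i,t}\}]$, where $\mathrm{Rev}_{\mathcal A}$ is the expected total revenue of $\mathcal A$. **BIB algorithm** (parameters: penalty function $\Psi:[0,1]\to[0,1]$ with $\Psi(0)=0,\Psi(1)=1$, and threshold $\gamma\in\mathbb{N}$). For each product $i$, every unit is permanently assigned to one batch $B_{i,j}$, $j=1,2,\dots$. Initially $B_{i,1}$ consists of the $c_i$ initial units and is "ready", $B_{i,2}=\emptyset$ is "charging", and $h_i=1$ (number of ready batches). In each period $t$: 1. For each $i$, each new unit of product $i$ added by the exogenous shock is put one at a time into the charging batch $B_{i,h_i+1}$; as soon as $|B_{i,h_i+1}|=\gamma$, that batch becomes ready, $h_i$ is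 increased by 1, and a new empty charging batch $B_{i,h_i+1}$ is created. Sold units that return rejoin the batch to which they were originally assigned. 2. For each ready batch $B_{i,j}$ ($j\in[h_i]$), let the normalized inventory level $f_{i,j,t}$ be the fraction of the $|B_{i,j}|$ units of $B_{i,j}$ currently available, i.e. $f_{i,j,t}=1-\frac{1}{|B_{i,j}|}\cdot\#\{t'\in\{t-d_i+1,\dots,t-1\}:\text{ a unit of }B_{i,j}\text{ was sold at }t'\}$. 3. Using the oracle with $\hat R_i=r_i\Psi(\max_{j\in[h_i]}f_{i,j,t})$, compute and offer $S_t\in\arg\max_{S\in\mathcal{S}}\sum_{i\in S}r_i\Psi(\max_{j\in[h_i]}f_{i,j,t})\phi_t(S,i)$. 4. If consumer $t$ chooses product $i^*$, allocate an available unit from batch $B_{i^*,j^*}$ with $j^*\in\arg\max_{j\in[h_{i^*}]}f_{i^*,j,t}$. -}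

module Defs where

open import Algebra.Bundles using (CommutativeRing)
open import Algebra.Core using (Op₁; Op₂)
open import Algebra.Structures using (IsCommutativeRing)
open import Data.Fin.Base using (Fin; toℕ)
import Data.Fin.Properties as Fin
open import Data.Fin.Subset using (Subset; _∈_; _∉_; _⊆_; _∪_; ⁅_⁆; ∣_∣)
open import Data.List.Base using (List; []; _∷_; length; filter; take)
open import Data.Maybe.Base using (Maybe; just; nothing)
import Data.Maybe.Properties as Maybe
open import Data.Nat.Base as ℕ using (ℕ; zero; suc; NonZero; _∸_)
open import Data.Nat.GeneralisedArithmetic using (iterate)
import Data.Nat.Properties as ℕ
open import Data.Product.Base using (∃-syntax; _×_; _,_)
import Data.Product.Properties as Product
open import Data.Unit.Base using (⊤)
open import Data.Vec.Functional using (Vector; head; tail; foldr)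
open import Level using (0ℓ) renaming (suc to lsuc)
open import Relation.Binary.Bundles using (DecTotalOrder)
open import Relation.Binary.Core using (Rel)
open import Relation.Binary.PropositionalEquality.Core using (_≡_; _≢_)
open import Relation.Binary.Structures using (IsDecTotalOrder)
open import Relation.Nullary.Decidable.Core using (yes; no)
open import Relation.Unary using (Pred; Satisfiable)
import Algebra.Construct.NaturalChoice.Max as Max
import Algebra.Construct.NaturalChoice.Min as Min
import Algebra.Definitions.RawMonoid as RawMonoid
import Relation.Binary.Construct.NonStrictToStrict as Strict

foldr₁ : ∀ {A : Set} {n} .{{_ : NonZero n}} → Op₂ A → Vector A n → A
foldr₁ {n = suc n} _∙_ v = foldr _∙_ (head v) (tail v)

-- The classical real numbers, characterised up to isomorphism as the
-- (decidably) ordered field in which every inhabited subset that is bounded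
-- above has a least upper bound.  Inverse and supremum are total operations;
-- their values at 0 and at empty or unbounded subsets are unconstrained.
record CompleteOrderedField : Set (lsuc 0ℓ) where
  infix  4 _≤_
  infixl 6 _+_
  infixl 7 _*_
  infix  8 -_
  infix  9 _⁻¹
  field
    ℝ                 : Set
    _+_ _*_           : Op₂ ℝ
    -_ _⁻¹            : Op₁ ℝ
    0# 1#             : ℝ
    _≤_               : Rel ℝ 0ℓ
    isCommutativeRing : IsCommutativeRing _≡_ _+_ _*_ -_ 0# 1#
    0≢1               : 0# ≢ 1#
    *-inverseʳ        : ∀ x → x ≢ 0# → x * x ⁻¹ ≡ 1#
    isDecTotalOrder   : IsDecTotalOrder _≡_ _≤_
    +-monoˡ-≤         : ∀ z {x y} → x ≤ y → x + z ≤ y + z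
    *-nonNeg          : ∀ {x y} → 0# ≤ x → 0# ≤ y → 0# ≤ x * y

  IsUpperBound : Pred ℝ 0ℓ → Pred ℝ 0ℓ
  IsUpperBound P u = ∀ {x} → P x → x ≤ u

  field
    sup       : Pred ℝ 0ℓ → ℝ
    sup-upper : ∀ P → Satisfiable P → Satisfiable (IsUpperBound P) →
                IsUpperBound P (sup P)
    sup-least : ∀ P → Satisfiable P → Satisfiable (IsUpperBound P) →
                ∀ {u} → IsUpperBound P u → sup P ≤ u

module RealAnalysis (F : CompleteOrderedField) where
  open CompleteOrderedField F public

  commutativeRing : CommutativeRing 0ℓ 0ℓ
  commutativeRing = record { isCommutativeRing = isCommutativeRing }

  decTotalOrder : DecTotalOrder 0ℓ 0ℓ 0ℓ
  decTotalOrder = record { isDecTotalOrder = isDecTotalOrder }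

  open CommutativeRing commutativeRing public using (_-_)
  open RawMonoid (CommutativeRing.+-rawMonoid commutativeRing) public
    using (sum) renaming (_×_ to _·_)
  open Strict _≡_ _≤_ public using (_<_)
  open Max (DecTotalOrder.totalOrder decTotalOrder) public using (_⊔_)
  open Min (DecTotalOrder.totalOrder decTotalOrder) public using (_⊓_)

  infixl 7 _/_
  _/_ : Op₂ ℝ
  x / y = x * y ⁻¹

  fromℕ : ℕ → ℝ
  fromℕ k = k · 1#

  ∣_∣ᵣ : Op₁ ℝ
  ∣ x ∣ᵣ = x ⊔ (- x)

  inf : Pred ℝ 0ℓ → ℝ
  inf P = - sup (λ y → P (- y))

  infix 4 _∈[_,_]
  _∈[_,_] : ℝ → ℝ → ℝ → Set
  x ∈[ a , b ] = a ≤ x × x ≤ b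

  -- The minimum of f over [a , b] whenever it is attained, as it is for
  -- continuous f.
  min[_,_] : ℝ → ℝ → (ℝ → ℝ) → ℝ
  min[ a , b ] f = inf λ y → ∃[ x ] (x ∈[ a , b ] × y ≡ f x)

  -- LowerSum f a b s: s is the integral over [a , b] of a step function lying
  -- below f.
  data LowerSum (f : ℝ → ℝ) : ℝ → ℝ → ℝ → Set where
    empty : ∀ {a} → LowerSum f a a 0#
    step  : ∀ {a b c m s} → a ≤ b →
            (∀ y → y ∈[ a , b ] → m ≤ f y) →
            LowerSum f b c s →
            LowerSum f a c (m * (b - a) + s)

  -- The lower Darboux integral.  It is the Riemann integral for every
  -- Riemann-integrable f, in particular for f monotone on [a , b].
  ∫ : (ℝ → ℝ) → ℝ → ℝ → ℝ
  ∫ f a b = sup (LowerSum f a b)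

  -- One-sided at the endpoints.
  DifferentiableOn[_,_] : ℝ → ℝ → (ℝ → ℝ) → Set
  DifferentiableOn[ a , b ] f =
    ∀ x → x ∈[ a , b ] → ∃[ f′ ] (∀ ε → 0# < ε → ∃[ δ ] (0# < δ ×
      (∀ y → y ∈[ a , b ] → ∣ y - x ∣ᵣ < δ →
        ∣ f y - f x - f′ * (y - x) ∣ᵣ ≤ ε * ∣ y - x ∣ᵣ)))

  ConcaveOn[_,_] : ℝ → ℝ → (ℝ → ℝ) → Set
  ConcaveOn[ a , b ] f =
    ∀ x y w → x ∈[ a , b ] → y ∈[ a , b ] → w ∈[ 0# , 1# ] →
      w * f x + (1# - w) * f y ≤ f (w * x + (1# - w) * y)

  -- Ψ : [0,1] → [0,1] is represented by a function on ℝ whose values outside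
  -- [0,1] are unconstrained.
  record IsPenalty (Ψ : ℝ → ℝ) : Set where
    field
      maps           : ∀ x → x ∈[ 0# , 1# ] → Ψ x ∈[ 0# , 1# ]
      at-0           : Ψ 0# ≡ 0#
      at-1           : Ψ 1# ≡ 1#
      monotone       : ∀ x y → x ∈[ 0# , 1# ] → y ∈[ 0# , 1# ] →
                       x ≤ y → Ψ x ≤ Ψ y
      concave        : ConcaveOn[ 0# , 1# ] Ψ
      differentiable : DifferentiableOn[ 0# , 1# ] Ψ

  module Bound (Ψ : ℝ → ℝ) (γ c₀ : ℕ) where
    1/c₀ 1/γ γ/c₀ : ℝ
    1/c₀ = 1# / fromℕ c₀
    1/γ  = 1# / fromℕ γ
    γ/c₀ = fromℕ γ / fromℕ c₀

    Γ₁ Γ₂ Γ : ℝ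
    Γ₁ = min[ 0# , 1# - 1/c₀ ] λ x →
      (1# - x) / (1/c₀ + (1# + γ/c₀) * (1# - Ψ x) + ∫ Ψ (x + 1/c₀) 1#)
    Γ₂ = min[ 0# , 1# - 1/γ ] λ x →
      (1# - x) / (1/γ + (1# - Ψ x) + ∫ Ψ (x + 1/γ) 1#)
    Γ  = Γ₁ ⊓ Γ₂

module Assortment (F : CompleteOrderedField) where
  open RealAnalysis F public

  record Products (n : ℕ) : Set where
    field
      price              : Fin n → ℝ
      duration           : Fin n → ℕ
      inventory          : Fin n → ℕ
      price-nonNeg       : ∀ i → 0# ≤ price i
      duration-positive  : ∀ i → 1 ℕ.≤ duration i
      inventory-positive : ∀ i → 1 ℕ.≤ inventory i

    minInventory : .{{_ : NonZero n}} → ℕ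
    minInventory = foldr₁ ℕ._⊓_ inventory

  record Assortments (n : ℕ) : Set₁ where
    field
      Feasible        : Pred (Subset n) 0ℓ
      nonempty        : Satisfiable Feasible
      downward-closed : ∀ {S S′} → Feasible S → S′ ⊆ S → Feasible S′

  -- Only the values on feasible assortments matter.  That probabilities are
  -- at most 1 and that prob ∅ i ≡ 0# follow from the fields.
  record ChoiceModel {n} (𝒮 : Assortments n) : Set where
    open Assortments 𝒮
    field
      prob           : Subset n → Fin n → ℝ
      prob-nonNeg    : ∀ {S} → Feasible S → ∀ i → 0# ≤ prob S i
      prob-total     : ∀ {S} → Feasible S → sum (prob S) ≤ 1#
      prob-support   : ∀ {S} → Feasible S → ∀ {i} → i ∉ S → prob S i ≡ 0#
      substitutable  : ∀ {S i j} → j ≢ i → Feasible S → Feasible (S ∪ ⁅ j ⁆) →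
                       prob (S ∪ ⁅ j ⁆) i ≤ prob S i

    value : Vector ℝ n → Subset n → ℝ
    value R̂ S = sum (λ i → R̂ i * prob S i)

    record IsSmallestMaximizer (R̂ : Vector ℝ n) (S : Subset n) : Set where
      field
        feasible : Feasible S
        maximal  : ∀ {S′} → Feasible S′ → value R̂ S′ ≤ value R̂ S
        smallest : ∀ {S′} → Feasible S′ → value R̂ S′ ≡ value R̂ S →
                   ∣ S ∣ ℕ.≤ ∣ S′ ∣

  -- Periods are numbered from 0; with horizon T only φ t and ξ t for t < T
  -- enter the definitions of revenue and feasibility.
  module Market {n} (products : Products n) (𝒮 : Assortments n)
                (φ : ℕ → ChoiceModel 𝒮) (ξ : ℕ → Fin n → ℕ) where
    open Products products public
    open Assortments 𝒮 public

    probAt : ℕ → Subset n → Fin n → ℝ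
    probAt t = ChoiceModel.prob (φ t)

    -- Units of product i added exogenously in the first t periods.
    arrived : Fin n → ℕ → ℕ
    arrived i zero    = 0
    arrived i (suc t) = arrived i t ℕ.+ ξ t i

    -- The consumers' past choices, most recent first, so that length h is the
    -- current period.
    History : Set
    History = List (Maybe (Fin n))

    -- An adaptive policy; in the benchmark it is chosen after φ and ξ.
    Policy : Set
    Policy = History → Subset n

    -- A unit sold in period t′ is away during t′, …, t′ + duration i ∸ 1, so
    -- the units away are those sold in the last duration i ∸ 1 periods.
    away : Fin n → History → ℕ
    away i h = length (filter (λ e → Maybe.≡-dec Fin._≟_ e (just i))
                              (take (duration i ∸ 1) h))

    Available : History → Fin n → Set
    Available h i = away i h ℕ.< inventory i ℕ.+ arrived i (suc (length h))

    -- Expected revenue, respectively inventory feasibility, of a policy over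
    -- the next k periods, given the history.
    revenueFrom : Policy → ℕ → History → ℝ
    revenueFrom π zero    h = 0#
    revenueFrom π (suc k) h =
      sum (λ i → p i * (price i + revenueFrom π k (just i ∷ h)))
        + (1# - sum p) * revenueFrom π k (nothing ∷ h)
      where
      p : Fin n → ℝ
      p = probAt (length h) (π h)

    FeasibleFrom : Policy → ℕ → History → Set
    FeasibleFrom π zero    h = ⊤
    FeasibleFrom π (suc k) h =
      Feasible (π h)
        × (∀ i → i ∈ π h → Available h i)
        × (∀ i → i ∈ π h → FeasibleFrom π k (just i ∷ h))
        × FeasibleFrom π k (nothing ∷ h)

    revenue : Policy → ℕ → ℝ
    revenue π T = revenueFrom π T []

    -- Only finitely many revenues occur for a given T, so this is a maximum.
    OPT : ℕ → ℝ
    OPT T = sup λ v → ∃[ π ] (FeasibleFrom π T [] × v ≡ revenue π T)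

    module Batching (γ : ℕ) where

      -- There are suc extra ready batches; charging is the size of the
      -- charging batch.
      record Batches : Set where
        constructor batches
        field
          extra charging : ℕ

        ready : ℕ
        ready = suc extra

      addUnit : Batches → Batches
      addUnit (batches e q) with suc q ℕ.≟ γ
      ... | yes _ = batches (suc e) 0
      ... | no  _ = batches e (suc q)

      -- The batches of product i in period t, after that period's exogenous
      -- shock.
      batchesAt : Fin n → ℕ → Batches
      batchesAt i t = iterate addUnit (batches 0 0) (arrived i (suc t))

      ready : Fin n → ℕ → ℕ
      ready i t = Batches.ready (batchesAt i t)

      batchSize : Fin n → ℕ → ℕ
      batchSize i zero    = inventory i
      batchSize i (suc j) = γ

      -- just (i , j) records the sale of a unit of the j-th batch of product i,
      -- counting from 0.
      BatchHistory : Set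
      BatchHistory = List (Maybe (Fin n × ℕ))

      awayFrom : Fin n → ℕ → BatchHistory → ℕ
      awayFrom i j h =
        length (filter (λ e → Maybe.≡-dec (Product.≡-dec Fin._≟_ ℕ._≟_)
                                          e (just (i , j)))
                       (take (duration i ∸ 1) h))

      levels : (h : BatchHistory) (i : Fin n) → Vector ℝ (ready i (length h))
      levels h i j =
        1# - fromℕ (awayFrom i (toℕ j) h) / fromℕ (batchSize i (toℕ j))

      Oracle : Set
      Oracle = ℕ → Vector ℝ n → Subset n

      IsExactOracle : Oracle → Set
      IsExactOracle oracle =
        ∀ t R̂ → (∀ i → 0# ≤ R̂ i) →
          ChoiceModel.IsSmallestMaximizer (φ t) R̂ (oracle t R̂)

      -- How ties among the fullest ready batches are broken is left open.
      BatchRule : Set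
      BatchRule = (h : BatchHistory) (i : Fin n) → Fin (ready i (length h))

      SelectsFullest : BatchRule → Set
      SelectsFullest rule = ∀ h i j → levels h i j ≤ levels h i (rule h i)

      module Algorithm (Ψ : ℝ → ℝ) (oracle : Oracle) (rule : BatchRule) where

        offer : BatchHistory → Subset n
        offer h =
          oracle (length h) (λ i → price i * Ψ (foldr₁ _⊔_ (levels h i)))

        allocate : History → BatchHistory
        allocate []           = []
        allocate (nothing ∷ h) = nothing ∷ allocate h
        allocate (just i ∷ h)  =
          just (i , toℕ (rule (allocate h) i)) ∷ allocate h

        -- No availability check is needed: a product whose ready units are
        -- all away has weight 0 and so is not in a smallest maximizer.
        BIB : Policy
        BIB h = offer (allocate h)

{-# OPTIONS --safe #-}
module Submission where

-- Let the benchmark and BIB run independently, and write ψ for Ψ of the level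
-- of the fullest ready batch.  BIB offers an assortment maximizing the expected
-- price * ψ, so it suffices to show for each product and each pair of sample
-- paths that Γ * Σ (1 - ψ) over the benchmark's sales is at most Σ (1 - Γ * ψ)
-- over BIB's sales.
--
-- Each benchmark sale is assigned to a slot of a ready batch in such a way that
-- sales assigned to the same slot are at least one usage duration apart.  If k
-- of the b units of the batch are away at such a sale, then 1 - ψ is at most
-- 1 - Ψ(1 - k/b).  The k sales of these units in BIB had ψ at most Ψ(1),
-- Ψ(1 - 1/b), …, Ψ(1 - (k-1)/b), so they contribute at least
-- k - Γ * Σ_{l<k} Ψ(1 - l/b), and by the choice of Γ this pays for the sale in
-- all slots of the batch.  For a fixed slot, the BIB sales paying for different
-- benchmark sales are different.

open import Defs
open import Algebra.Bundles using (CommutativeRing; RawRing)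
import Algebra.Construct.NaturalChoice.Max as Max
import Algebra.Construct.NaturalChoice.Min as Min
open import Algebra.Core using (Op₂)
import Algebra.Properties.Ring as RingProperties
import Algebra.Properties.Semiring.Mult as Mult
import Algebra.Properties.Semiring.Mult.TCOptimised as MultOptimised
import Algebra.Properties.Semiring.Sum as Sum
import Algebra.Solver.Ring as RingSolver
open import Algebra.Solver.Ring.AlmostCommutativeRing
  using (fromCommutativeRing; _-Raw-AlmostCommutative⟶_)
open import Data.Fin.Base using (Fin; zero; suc; toℕ; fromℕ<)
import Data.Fin.Properties as Fin
open import Data.Fin.Subset as Subset using (Subset; ⁅_⁆; _∪_) renaming (_∈_ to _∈ₛ_)
import Data.Fin.Subset.Properties as Subset
open import Data.List.Base using (List; []; _∷_; length; filter; take; catMaybes)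
open import Data.List.Membership.Propositional using (_∈_; _∉_)
open import Data.List.Membership.Propositional.Properties using (∈-filter⁺)
import Data.List.Properties as List
import Data.List.Relation.Unary.Any as Any
open import Data.List.Relation.Unary.Any using (here; there)
open import Data.Maybe.Base as Maybe using (Maybe; just; nothing)
import Data.Maybe.Properties as Maybe
open import Data.Nat.Base as ℕ using (ℕ; zero; suc; NonZero)
import Data.Nat.DivMod as ℕ
open import Data.Nat.GeneralisedArithmetic using (iterate)
import Data.Nat.Properties as ℕ
open import Data.List.Membership.DecPropositional ℕ._≟_ using (_∈?_)
open import Data.Product.Base using (_×_; _,_; ∃-syntax; proj₁; proj₂)
import Data.Product.Properties as Product
open import Data.Sum.Base using (_⊎_; inj₁; inj₂; [_,_]′)
open import Data.Unit.Base using (tt)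
open import Data.Vec.Functional using (Vector; head; tail; foldr)
open import Function.Base using (_∘_; flip)
open import Level using (0ℓ)
open import Relation.Binary.Bundles using (DecTotalOrder)
open import Relation.Binary.Core using (Rel)
open import Relation.Binary.Definitions using (Reflexive; Transitive)
open import Relation.Binary.PropositionalEquality
  using (_≡_; _≢_; refl; sym; trans; cong; cong₂; subst; subst₂; module ≡-Reasoning)
open import Relation.Nullary using (¬_; Dec; yes; no; contradiction; ¬?)
open import Relation.Unary using (Pred; Decidable)

-- Why comparing `1 - ψ` with `1 - Γ * ψ` is enough: with `ψ` read off BIB's current state, a
-- benchmark sale at price r is split as Γ r = Γ r ψ + Γ r (1 - ψ). In every period the first part
-- is paid in expectation by the share Γ r ψ of BIB's own sale, since the oracle maximizes over all
-- feasible assortments, the benchmark's included. Of a BIB sale r (1 - Γ ψ) remains, and this has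
-- to cover the second part. Independence of the two runs allows `ψ` to be fixed by BIB's path while
-- the benchmark's choice is averaged separately.
--
-- The obstacle is reusability. Levels recover when units return, so only BIB sales within one
-- duration before a benchmark sale explain a low level then, and payments must come from that
-- window. Windows of nearby benchmark sales overlap; spreading these sales over slots, with each
-- BIB sale dividing its gain equally among the slots of its batch, keeps any gain from being spent
-- twice.
--
-- The terms 1/c₀ and 1/γ in Γ are discretization errors: sums over the grid of levels of a batch
-- are compared with an integral. Batch 0 may have a finer grid than 1/c₀, so the comparison is made
-- for all sizes from c₀ on.

module _ {A : Set} {P : Pred A 0ℓ} (P? : Decidable P) where
  count : List A → ℕ
  count xs = length (filter P? xs)

  count-accept : ∀ {x xs} → P x → count (x ∷ xs) ≡ suc (count xs)
  count-accept Px = cong length (List.filter-accept P? Px)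

  count-reject : ∀ {x xs} → ¬ P x → count (x ∷ xs) ≡ count xs
  count-reject ¬Px = cong length (List.filter-reject P? ¬Px)

  count-∷-mono : ∀ {m} x xs → count xs ℕ.≤ m → count (x ∷ xs) ℕ.≤ suc m
  count-∷-mono x xs le with P? x
  ... | yes _ = ℕ.s≤s le
  ... | no  _ = ℕ.m≤n⇒m≤1+n le

  count-mono-∷ : ∀ x {xs ys} → count xs ℕ.≤ count ys → count (x ∷ xs) ℕ.≤ count (x ∷ ys)
  count-mono-∷ x le with P? x
  ... | yes _ = ℕ.s≤s le
  ... | no  _ = le

  count-take-mono : ∀ {m n} → m ℕ.≤ n → ∀ xs → count (take m xs) ℕ.≤ count (take n xs)
  count-take-mono ℕ.z≤n       xs       = ℕ.z≤n
  count-take-mono (ℕ.s≤s m≤n) []       = ℕ.z≤n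
  count-take-mono (ℕ.s≤s m≤n) (x ∷ xs) = count-mono-∷ x {take _ xs} (count-take-mono m≤n xs)

  count-take-∷ : ∀ n x xs → count (take n (x ∷ xs)) ℕ.≤ suc (count (take n xs))
  count-take-∷ zero    x xs = ℕ.z≤n
  count-take-∷ (suc n) x xs =
    count-∷-mono x (take n xs) (count-take-mono (ℕ.n≤1+n n) xs)

  count-take-reject : ∀ n {x} xs → ¬ P x → count (take n (x ∷ xs)) ℕ.≤ count (take n xs)
  count-take-reject zero    xs ¬Px = ℕ.z≤n
  count-take-reject (suc n) xs ¬Px =
    subst (ℕ._≤ _) (sym (count-reject {xs = take n xs} ¬Px)) (count-take-mono (ℕ.n≤1+n n) xs)

-- Pigeonhole: candidates are tried downwards from `length xs`, and each one found in the list is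
-- deleted from it. The bound on `k` is what later puts a free slot into a ready batch.
free : ∀ xs → ∃[ k ] (k ℕ.≤ length xs × k ∉ xs)
free xs = go (length xs) xs ℕ.≤-refl
  where
  go : ∀ m xs → length xs ℕ.≤ m → ∃[ k ] (k ℕ.≤ m × k ∉ xs)
  go m xs le with m ∈? xs
  ... | no m∉xs  = m , ℕ.≤-refl , m∉xs
  ... | yes m∈xs with ℕ.<-≤-trans
      (List.filter-notAll (¬? ∘ (ℕ._≟ m)) xs (Any.map (λ eq neq → neq (sym eq)) m∈xs)) le
  go (suc m) xs le | yes _ | ℕ.s≤s le′ with go m (filter (¬? ∘ (ℕ._≟ suc m)) xs) le′
  ... | k , k≤m , k∉ = k , ℕ.m≤n⇒m≤1+n k≤m ,
    λ k∈xs → k∉ (∈-filter⁺ (¬? ∘ (ℕ._≟ suc m)) k∈xs (ℕ.<⇒≢ (ℕ.s≤s k≤m)))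

just∈⇒∈-catMaybes : ∀ {k : ℕ} {xs} → just k ∈ xs → k ∈ catMaybes xs
just∈⇒∈-catMaybes {xs = just _ ∷ _}  (here refl) = here refl
just∈⇒∈-catMaybes {xs = just _ ∷ _}  (there k∈) = there (just∈⇒∈-catMaybes k∈)
just∈⇒∈-catMaybes {xs = nothing ∷ _} (there k∈) = just∈⇒∈-catMaybes k∈

module _ {A : Set} {_∙_ : Op₂ A} where

  foldr₁-preserves : (P : A → Set) → (∀ {x y} → P x → P y → P (x ∙ y)) →
                     ∀ {n} .{{_ : NonZero n}} (v : Vector A n) →
                     (∀ i → P (v i)) → P (foldr₁ _∙_ v)
  foldr₁-preserves P P-∙ {suc n} v Pv = go (tail v) (Pv ∘ suc)
    where
    go : ∀ {m} (w : Vector A m) → (∀ i → P (w i)) → P (foldr _∙_ (head v) w)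
    go {zero}  w Pw = Pv zero
    go {suc m} w Pw = P-∙ (Pw zero) (go (tail w) (Pw ∘ suc))

  foldr₁-dominates : (R : Rel A 0ℓ) → Reflexive R → Transitive R →
                     (∀ x y → R x (x ∙ y)) → (∀ x y → R y (x ∙ y)) →
                     ∀ {n} .{{_ : NonZero n}} (v : Vector A n) →
                     ∀ i → R (v i) (foldr₁ _∙_ v)
  foldr₁-dominates R R-refl R-trans Rˡ Rʳ {suc n} v = λ where
      zero    → base (tail v)
      (suc i) → entry (tail v) i
    where
    base : ∀ {m} (w : Vector A m) → R (head v) (foldr _∙_ (head v) w)
    base {zero}  w = R-refl
    base {suc m} w = R-trans (base (tail w)) (Rʳ _ _)

    entry : ∀ {m} (w : Vector A m) i → R (w i) (foldr _∙_ (head v) w)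
    entry {suc m} w zero    = Rˡ _ _
    entry {suc m} w (suc i) = R-trans (entry (tail w) i) (Rʳ _ _)

-- Arithmetic of the ordered field: ring solver, inequalities, finite sums.

module OrderedField (F : CompleteOrderedField) where
  open RealAnalysis F
  open CommutativeRing commutativeRing public
    using (+-comm; +-identityˡ; +-identityʳ; -‿inverseʳ; *-comm; *-identityˡ; *-identityʳ;
           zeroˡ; zeroʳ; distribˡ; semiring; ring)
  open DecTotalOrder decTotalOrder public
    using (total; antisym; _≟_)
    renaming (refl to ≤-refl; trans to ≤-trans; reflexive to ≤-reflexive)
  open Max (DecTotalOrder.totalOrder decTotalOrder) public using (x≤x⊔y; x≤y⊔x; ⊔-lub)
  open Min (DecTotalOrder.totalOrder decTotalOrder) public using (x⊓y≤x; x⊓y≤y; ⊓-glb)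
  open Sum semiring public using (sum-cong-≗; ∑-distrib-+; *-distribˡ-sum)

  private
    module U = Mult semiring
    module O = MultOptimised semiring

  fromℕ-+ : ∀ m n → fromℕ (m ℕ.+ n) ≡ fromℕ m + fromℕ n
  fromℕ-+ = U.×-homo-+ 1#

  fromℕ-* : ∀ m n → fromℕ (m ℕ.* n) ≡ fromℕ m * fromℕ n
  fromℕ-* = U.×1-homo-*

  -- The coefficients of the solver are reduced formal differences of natural
  -- numbers, interpreted so that (1 , 0) and (0 , 0) are literally 1# and 0#.
  module Coefficients where
    open ≡-Reasoning

    Difference : Set
    Difference = ℕ × ℕ

    ⟦_⟧ : Difference → ℝ
    ⟦ a , zero ⟧  = a O.× 1#
    ⟦ a , suc b ⟧ = a O.× 1# - suc b O.× 1#

    reduce : ℕ → ℕ → Difference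
    reduce (suc a) (suc b) = reduce a b
    reduce a       b       = a , b

    differences : RawRing _ _
    differences = record
      { Carrier = Difference
      ; _≈_     = _≡_
      ; _+_     = λ (a , b) (c , d) → reduce (a ℕ.+ c) (b ℕ.+ d)
      ; _*_     = λ (a , b) (c , d) → reduce (a ℕ.* c ℕ.+ b ℕ.* d) (a ℕ.* d ℕ.+ b ℕ.* c)
      ; -_      = λ (a , b) → b , a
      ; 0#      = 0 , 0
      ; 1#      = 1 , 0
      }

    private
      module R = CommutativeRing commutativeRing
      open RingProperties ring using (-‿distribˡ-*; -‿distribʳ-*; -0#≈0#; -‿involutive; -‿anti-homo-+)

      +-medial : ∀ a b c d → (a + b) + (c + d) ≡ (a + c) + (b + d)
      +-medial a b c d = begin
        (a + b) + (c + d)  ≡⟨ R.+-assoc a b (c + d) ⟩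
        a + (b + (c + d))  ≡⟨ cong (a +_) (sym (R.+-assoc b c d)) ⟩
        a + ((b + c) + d)  ≡⟨ cong (λ z → a + (z + d)) (+-comm b c) ⟩
        a + ((c + b) + d)  ≡⟨ cong (a +_) (R.+-assoc c b d) ⟩
        a + (c + (b + d))  ≡⟨ sym (R.+-assoc a c (b + d)) ⟩
        (a + c) + (b + d)  ∎

      -‿+ : ∀ a b → - (a + b) ≡ - a + - b
      -‿+ a b = trans (-‿anti-homo-+ a b) (+-comm _ _)

      ⟦⟧-fromℕ : ∀ a b → ⟦ a , b ⟧ ≡ fromℕ a - fromℕ b
      ⟦⟧-fromℕ a zero = begin
        a O.× 1#       ≡⟨ O.×ᵤ≈× a 1# ⟨
        fromℕ a        ≡⟨ +-identityʳ _ ⟨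
        fromℕ a + 0#   ≡⟨ cong (fromℕ a +_) -0#≈0# ⟨
        fromℕ a - 0#   ∎
      ⟦⟧-fromℕ a (suc b) =
        cong₂ _-_ (sym (O.×ᵤ≈× a 1#)) (sym (O.×ᵤ≈× (suc b) 1#))

      ⟦⟧-reduce : ∀ a b → ⟦ reduce a b ⟧ ≡ fromℕ a - fromℕ b
      ⟦⟧-reduce zero    b       = ⟦⟧-fromℕ zero b
      ⟦⟧-reduce (suc a) zero    = ⟦⟧-fromℕ (suc a) zero
      ⟦⟧-reduce (suc a) (suc b) = begin
        ⟦ reduce a b ⟧                            ≡⟨ ⟦⟧-reduce a b ⟩
        fromℕ a - fromℕ b                         ≡⟨ +-identityˡ _ ⟨
        0# + (fromℕ a - fromℕ b)                  ≡⟨ cong (_+ (fromℕ a - fromℕ b)) (-‿inverseʳ 1#) ⟨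
        (1# - 1#) + (fromℕ a - fromℕ b)           ≡⟨ +-medial _ _ _ _ ⟩
        (1# + fromℕ a) + (- 1# + - fromℕ b)       ≡⟨ cong ((1# + fromℕ a) +_) (-‿+ _ _) ⟨
        fromℕ (suc a) - fromℕ (suc b)             ∎

      +-homo : ∀ a b c d → ⟦ reduce (a ℕ.+ c) (b ℕ.+ d) ⟧ ≡ ⟦ a , b ⟧ + ⟦ c , d ⟧
      +-homo a b c d = begin
        ⟦ reduce (a ℕ.+ c) (b ℕ.+ d) ⟧
          ≡⟨ ⟦⟧-reduce (a ℕ.+ c) (b ℕ.+ d) ⟩
        fromℕ (a ℕ.+ c) - fromℕ (b ℕ.+ d)
          ≡⟨ cong₂ _-_ (fromℕ-+ a c) (fromℕ-+ b d) ⟩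
        (fromℕ a + fromℕ c) - (fromℕ b + fromℕ d)
          ≡⟨ cong ((fromℕ a + fromℕ c) +_) (-‿+ _ _) ⟩
        (fromℕ a + fromℕ c) + (- fromℕ b + - fromℕ d)
          ≡⟨ +-medial _ _ _ _ ⟩
        (fromℕ a - fromℕ b) + (fromℕ c - fromℕ d)
          ≡⟨ cong₂ _+_ (⟦⟧-fromℕ a b) (⟦⟧-fromℕ c d) ⟨
        ⟦ a , b ⟧ + ⟦ c , d ⟧ ∎

      -‿homo : ∀ a b → ⟦ b , a ⟧ ≡ - ⟦ a , b ⟧
      -‿homo a b = begin
        ⟦ b , a ⟧                 ≡⟨ ⟦⟧-fromℕ b a ⟩
        fromℕ b - fromℕ a         ≡⟨ +-comm _ _ ⟩
        - fromℕ a + fromℕ b       ≡⟨ cong (- fromℕ a +_) (-‿involutive _) ⟨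
        - fromℕ a + - - fromℕ b   ≡⟨ -‿+ _ _ ⟨
        - (fromℕ a - fromℕ b)     ≡⟨ cong -_ (⟦⟧-fromℕ a b) ⟨
        - ⟦ a , b ⟧               ∎

      fromℕ-product : ∀ a b c d → fromℕ (a ℕ.* c ℕ.+ b ℕ.* d) ≡ fromℕ a * fromℕ c + fromℕ b * fromℕ d
      fromℕ-product a b c d =
        trans (fromℕ-+ (a ℕ.* c) (b ℕ.* d)) (cong₂ _+_ (fromℕ-* a c) (fromℕ-* b d))

      expand : ∀ a b c d → (a - b) * (c - d) ≡ (a * c + b * d) - (a * d + b * c)
      expand a b c d = begin
        (a - b) * (c - d)
          ≡⟨ R.distribʳ (c - d) a (- b) ⟩
        a * (c - d) + - b * (c - d)
          ≡⟨ cong₂ _+_ (distribˡ a c (- d)) (distribˡ (- b) c (- d)) ⟩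
        (a * c + a * - d) + (- b * c + - b * - d)
          ≡⟨ cong ((a * c + a * - d) +_) (+-comm _ _) ⟩
        (a * c + a * - d) + (- b * - d + - b * c)
          ≡⟨ +-medial _ _ _ _ ⟩
        (a * c + - b * - d) + (a * - d + - b * c)
          ≡⟨ cong₂ _+_ (cong (a * c +_) neg-neg)
               (cong₂ _+_ (sym (-‿distribʳ-* a d)) (sym (-‿distribˡ-* b c))) ⟩
        (a * c + b * d) + (- (a * d) + - (b * c))
          ≡⟨ cong ((a * c + b * d) +_) (-‿+ _ _) ⟨
        (a * c + b * d) - (a * d + b * c) ∎
        where
        neg-neg : - b * - d ≡ b * d
        neg-neg = begin
          - b * - d      ≡⟨ -‿distribˡ-* b (- d) ⟨
          - (b * - d)    ≡⟨ cong -_ (-‿distribʳ-* b d) ⟨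
          - - (b * d)    ≡⟨ -‿involutive _ ⟩
          b * d          ∎

      *-homo : ∀ a b c d →
               ⟦ reduce (a ℕ.* c ℕ.+ b ℕ.* d) (a ℕ.* d ℕ.+ b ℕ.* c) ⟧ ≡ ⟦ a , b ⟧ * ⟦ c , d ⟧
      *-homo a b c d = begin
        ⟦ reduce (a ℕ.* c ℕ.+ b ℕ.* d) (a ℕ.* d ℕ.+ b ℕ.* c) ⟧
          ≡⟨ ⟦⟧-reduce (a ℕ.* c ℕ.+ b ℕ.* d) (a ℕ.* d ℕ.+ b ℕ.* c) ⟩
        fromℕ (a ℕ.* c ℕ.+ b ℕ.* d) - fromℕ (a ℕ.* d ℕ.+ b ℕ.* c)
          ≡⟨ cong₂ _-_ (fromℕ-product a b c d) (fromℕ-product a b d c) ⟩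
        (fromℕ a * fromℕ c + fromℕ b * fromℕ d) - (fromℕ a * fromℕ d + fromℕ b * fromℕ c)
          ≡⟨ expand _ _ _ _ ⟨
        (fromℕ a - fromℕ b) * (fromℕ c - fromℕ d)
          ≡⟨ cong₂ _*_ (⟦⟧-fromℕ a b) (⟦⟧-fromℕ c d) ⟨
        ⟦ a , b ⟧ * ⟦ c , d ⟧ ∎

    homomorphism : differences -Raw-AlmostCommutative⟶ fromCommutativeRing commutativeRing
    homomorphism = record
      { ⟦_⟧    = ⟦_⟧
      ; +-homo = λ (a , b) (c , d) → +-homo a b c d
      ; *-homo = λ (a , b) (c , d) → *-homo a b c d
      ; -‿homo = λ (a , b) → -‿homo a b
      ; 0-homo = refl
      ; 1-homo = refl
      }

    _coefficient≟_ : ∀ p q → Maybe (⟦ p ⟧ ≡ ⟦ q ⟧)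
    (a , b) coefficient≟ (c , d) with a ℕ.+ d ℕ.≟ c ℕ.+ b
    ... | no _   = nothing
    ... | yes eq = just (begin
      ⟦ a , b ⟧
        ≡⟨ +-identityʳ _ ⟨
      ⟦ a , b ⟧ + 0#
        ≡⟨ cong (⟦ a , b ⟧ +_) (trans (⟦⟧-fromℕ d d) (-‿inverseʳ _)) ⟨
      ⟦ a , b ⟧ + ⟦ d , d ⟧
        ≡⟨ +-homo a b d d ⟨
      ⟦ reduce (a ℕ.+ d) (b ℕ.+ d) ⟧
        ≡⟨ cong₂ (λ x y → ⟦ reduce x y ⟧) eq (ℕ.+-comm b d) ⟩
      ⟦ reduce (c ℕ.+ b) (d ℕ.+ b) ⟧
        ≡⟨ +-homo c d b b ⟩
      ⟦ c , d ⟧ + ⟦ b , b ⟧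
        ≡⟨ cong (⟦ c , d ⟧ +_) (trans (⟦⟧-fromℕ b b) (-‿inverseʳ _)) ⟩
      ⟦ c , d ⟧ + 0#
        ≡⟨ +-identityʳ _ ⟩
      ⟦ c , d ⟧ ∎)

  open RingSolver Coefficients.differences (fromCommutativeRing commutativeRing)
    Coefficients.homomorphism Coefficients._coefficient≟_ public
    using (Polynomial; solve; con; _:=_; _:+_; _:*_; :-_; _:-_)

  :0 :1 : ∀ {n} → Polynomial n
  :0 = con (0 , 0)
  :1 = con (1 , 0)

  gap : ∀ {x y} → x ≤ y → 0# ≤ y - x
  gap {x} {y} x≤y = subst (_≤ y - x) (-‿inverseʳ x) (+-monoˡ-≤ (- x) x≤y)

  infixl 6 _⊹_
  infixl 7 _⊛_

  _⊹_ : ∀ {x y} → 0# ≤ x → 0# ≤ y → 0# ≤ x + y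
  _⊹_ {x} {y} 0≤x 0≤y =
    ≤-trans 0≤y (subst (_≤ x + y) (+-identityˡ y) (+-monoˡ-≤ y 0≤x))

  _⊛_ : ∀ {x y} → 0# ≤ x → 0# ≤ y → 0# ≤ x * y
  _⊛_ = *-nonNeg

  -- An inequality is proved by exhibiting the difference of its sides as a
  -- combination of gaps of known inequalities; the identity is left to solve.
  certify : ∀ {x y e} → 0# ≤ e → y ≡ x + e → x ≤ y
  certify {x} {y} {e} 0≤e y≡x+e =
    subst₂ _≤_ (+-identityˡ x) (trans (+-comm e x) (sym y≡x+e)) (+-monoˡ-≤ x 0≤e)

  +-mono-≤ : ∀ {w x y z} → w ≤ x → y ≤ z → w + y ≤ x + z
  +-mono-≤ {w} {x} {y} {z} w≤x y≤z = certify (gap w≤x ⊹ gap y≤z)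
    (solve 4 (λ w x y z → x :+ z := (w :+ y) :+ ((x :- w) :+ (z :- y))) refl w x y z)

  *-monoˡ-≤ : ∀ {x y z} → 0# ≤ z → x ≤ y → z * x ≤ z * y
  *-monoˡ-≤ {x} {y} {z} 0≤z x≤y = certify (0≤z ⊛ gap x≤y)
    (solve 3 (λ x y z → z :* y := z :* x :+ z :* (y :- x)) refl x y z)

  0≤1 : 0# ≤ 1#
  0≤1 with total 0# 1#
  ... | inj₁ 0≤1 = 0≤1
  ... | inj₂ 1≤0 = subst (0# ≤_) (solve 0 ((:0 :- :1) :* (:0 :- :1) := :1) refl) (gap 1≤0 ⊛ gap 1≤0)

  1≰0 : ¬ 1# ≤ 0#
  1≰0 1≤0 = 0≢1 (antisym 0≤1 1≤0)

  0≤fromℕ : ∀ k → 0# ≤ fromℕ k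
  0≤fromℕ zero    = ≤-refl
  0≤fromℕ (suc k) = 0≤1 ⊹ 0≤fromℕ k

  fromℕ-mono : ∀ {k m} → k ℕ.≤ m → fromℕ k ≤ fromℕ m
  fromℕ-mono {k} {m} k≤m = certify (0≤fromℕ (m ℕ.∸ k))
    (trans (cong fromℕ (sym (ℕ.m+[n∸m]≡n k≤m))) (fromℕ-+ k (m ℕ.∸ k)))

  1≤fromℕ : ∀ {k} → 1 ℕ.≤ k → 1# ≤ fromℕ k
  1≤fromℕ 1≤k = ≤-trans (≤-reflexive (sym (+-identityʳ 1#))) (fromℕ-mono 1≤k)

  fromℕ≢0 : ∀ {k} → 1 ℕ.≤ k → fromℕ k ≢ 0#
  fromℕ≢0 1≤k eq = 1≰0 (subst (1# ≤_) eq (1≤fromℕ 1≤k))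

  0≤⁻¹ : ∀ {x} → 0# ≤ x → x ≢ 0# → 0# ≤ x ⁻¹
  0≤⁻¹ {x} 0≤x x≢0 with total 0# (x ⁻¹)
  ... | inj₁ 0≤x⁻¹ = 0≤x⁻¹
  ... | inj₂ x⁻¹≤0 = contradiction
    (subst₂ _≤_ (*-inverseʳ x x≢0) (zeroʳ x) (*-monoˡ-≤ 0≤x x⁻¹≤0)) 1≰0

  sum-mono : ∀ {n} {f g : Vector ℝ n} → (∀ i → f i ≤ g i) → sum f ≤ sum g
  sum-mono {zero}  f≤g = ≤-refl
  sum-mono {suc n} f≤g = +-mono-≤ (f≤g zero) (sum-mono (f≤g ∘ suc))

  sum-nonNeg : ∀ {n} {f : Vector ℝ n} → (∀ i → 0# ≤ f i) → 0# ≤ sum f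
  sum-nonNeg {zero}  0≤f = ≤-refl
  sum-nonNeg {suc n} 0≤f = 0≤f zero ⊹ sum-nonNeg (0≤f ∘ suc)

  term≤sum : ∀ {n} {f : Vector ℝ n} → (∀ i → 0# ≤ f i) → ∀ i → f i ≤ sum f
  term≤sum {suc n} {f} 0≤f zero = certify (sum-nonNeg (0≤f ∘ suc)) refl
  term≤sum {suc n} {f} 0≤f (suc i) =
    ≤-trans (term≤sum (0≤f ∘ suc) i) (certify (0≤f zero) (+-comm _ _))

  when : {P : Set} → Dec P → ℝ → ℝ
  when (yes _) x = x
  when (no _)  x = 0#

  when-yes : {P : Set} (P? : Dec P) {x : ℝ} → P → when P? x ≡ x
  when-yes (yes _) p = refl
  when-yes (no ¬p) p = contradiction p ¬p

  when-no : {P : Set} (P? : Dec P) {x : ℝ} → ¬ P → when P? x ≡ 0#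
  when-no (yes p) ¬p = contradiction p ¬p
  when-no (no _)  ¬p = refl

  0≤when : {P : Set} (P? : Dec P) {x : ℝ} → 0# ≤ x → 0# ≤ when P? x
  0≤when (yes _) 0≤x = 0≤x
  0≤when (no _)  0≤x = ≤-refl

  when≤ : {P : Set} (P? : Dec P) {x : ℝ} → 0# ≤ x → when P? x ≤ x
  when≤ (yes _) 0≤x = ≤-refl
  when≤ (no _)  0≤x = 0≤x

  sum-zero : ∀ {m} (g : Vector ℝ m) → (∀ j → g j ≡ 0#) → sum g ≡ 0#
  sum-zero {zero}  g g≡0 = refl
  sum-zero {suc m} g g≡0 =
    trans (cong₂ _+_ (g≡0 zero) (sum-zero (g ∘ suc) (g≡0 ∘ suc))) (+-identityʳ 0#)

  sum-single : ∀ {n} (f : Vector ℝ n) i → (∀ j → j ≢ i → f j ≡ 0#) → sum f ≡ f i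
  sum-single {suc n} f zero f≡0 = begin
    f zero + sum (f ∘ suc)
      ≡⟨ cong (f zero +_) (sum-zero (f ∘ suc) (λ j → f≡0 (suc j) λ ())) ⟩
    f zero + 0#   ≡⟨ +-identityʳ _ ⟩
    f zero        ∎
    where
    open ≡-Reasoning
  sum-single {suc n} f (suc i) f≡0 = begin
    f zero + sum (f ∘ suc)
      ≡⟨ cong₂ _+_ (f≡0 zero λ ())
            (sum-single (f ∘ suc) i λ j j≢i → f≡0 (suc j) (j≢i ∘ Fin.suc-injective)) ⟩
    0# + f (suc i)   ≡⟨ +-identityˡ _ ⟩
    f (suc i)        ∎
    where open ≡-Reasoning

  sum-when-interval : ∀ {K} lo m {P : ℕ → Set} (P? : ∀ k → Dec (P k)) →
                      (∀ {k} → P k → lo ℕ.≤ k × k ℕ.< lo ℕ.+ m) →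
                      ∀ {x} → 0# ≤ x → sum {K} (λ k → when (P? (toℕ k)) x) ≤ fromℕ m * x
  sum-when-interval {zero} lo m P? inside 0≤x = 0≤fromℕ m ⊛ 0≤x
  sum-when-interval {suc K} (suc lo) m P? inside {x} 0≤x
    rewrite when-no (P? 0) {x} (λ p → contradiction (proj₁ (inside p)) λ ()) =
    subst (_≤ fromℕ m * x) (sym (+-identityˡ _))
      (sum-when-interval {K} lo m (P? ∘ suc)
        (λ p → ℕ.s≤s⁻¹ (proj₁ (inside p)) , ℕ.s≤s⁻¹ (proj₂ (inside p))) 0≤x)
  sum-when-interval {suc K} zero zero P? inside {x} 0≤x
    rewrite when-no (P? 0) {x} (λ p → contradiction (proj₂ (inside p)) λ ()) =
    subst (_≤ 0# * x) (sym (+-identityˡ _))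
      (sum-when-interval {K} zero zero (P? ∘ suc) (λ p → contradiction (proj₂ (inside p)) λ ()) 0≤x)
  sum-when-interval {suc K} zero (suc m) P? inside {x} 0≤x =
    ≤-trans
      (+-mono-≤ (when≤ (P? 0) 0≤x)
        (sum-when-interval {K} zero m (P? ∘ suc) (λ p → ℕ.z≤n , ℕ.s≤s⁻¹ (proj₂ (inside p))) 0≤x))
      (≤-reflexive (solve 2 (λ m x → x :+ m :* x := (:1 :+ m) :* x) refl (fromℕ m) x))

  sumBelow : (ℕ → ℝ) → ℕ → ℝ
  sumBelow f zero    = 0#
  sumBelow f (suc k) = sumBelow f k + f k

  -- Minima of nonnegative functions over an interval.

  module _ {a b : ℝ} (a≤b : a ≤ b) {f : ℝ → ℝ} (0≤f : ∀ x → x ∈[ a , b ] → 0# ≤ f x) where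
    private
      -- inf P is - sup of this predicate.
      Reflected : ℝ → Set
      Reflected y = ∃[ x ] (x ∈[ a , b ] × - y ≡ f x)

      reflect : ∀ {x} → x ∈[ a , b ] → Reflected (- f x)
      reflect {x} x∈ = x , x∈ , solve 1 (λ y → :- (:- y) := y) refl (f x)

      reflected≤0 : ∀ {y} → Reflected y → y ≤ 0#
      reflected≤0 {y} (x , x∈ , eq) = certify (subst (0# ≤_) (sym eq) (0≤f x x∈))
        (solve 1 (λ y → :0 := y :+ (:- y)) refl y)

      satisfiable : ∃[ y ] Reflected y
      satisfiable = _ , reflect (≤-refl , a≤b)

    0≤min : 0# ≤ min[ a , b ] f
    0≤min = certify (gap (sup-least Reflected satisfiable (0# , reflected≤0) reflected≤0))
      (solve 1 (λ s → :- s := :0 :+ (:0 :- s)) refl _)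

    min≤ : ∀ x → x ∈[ a , b ] → min[ a , b ] f ≤ f x
    min≤ x x∈ = certify (gap (sup-upper Reflected satisfiable (0# , reflected≤0) (reflect x∈)))
      (solve 2 (λ s y → y := :- s :+ (s :- (:- y))) refl _ (f x))

-- Riemann sums of the penalty function and the inequalities encoded in Γ.

module PenaltyBound (F : CompleteOrderedField)
                    (Ψ : CompleteOrderedField.ℝ F → CompleteOrderedField.ℝ F)
                    (isPenalty : RealAnalysis.IsPenalty F Ψ) where
  open RealAnalysis F
  open OrderedField F
  open IsPenalty isPenalty

  -- The height of a step is at most `Ψ` at the left end of its cell, hence at most 1. The bound is
  -- what gives `∫` a meaning, as `sup` of an unbounded set is unconstrained; `a ≤ c` is carried
  -- along to keep the left ends inside the unit interval.
  LowerSum-bound : ∀ {a c s} → 0# ≤ a → c ≤ 1# → LowerSum Ψ a c s → a ≤ c × s ≤ c - a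
  LowerSum-bound 0≤a c≤1 empty = ≤-refl , ≤-reflexive (sym (-‿inverseʳ _))
  LowerSum-bound {a} {c} 0≤a c≤1 (step {b = b} {m = m} {s = s} a≤b m≤Ψ rest)
    with LowerSum-bound (≤-trans 0≤a a≤b) c≤1 rest
  ... | b≤c , s≤c-b = ≤-trans a≤b b≤c , certify
      (gap m≤1 ⊛ gap a≤b ⊹ gap s≤c-b)
      (solve 5 (λ a b c m s →
        c :- a := (m :* (b :- a) :+ s) :+ ((:1 :- m) :* (b :- a) :+ (c :- b :- s))) refl a b c m s)
    where
    m≤1 : m ≤ 1#
    m≤1 = ≤-trans (m≤Ψ a (≤-refl , a≤b)) (proj₂ (maps a (0≤a , ≤-trans a≤b (≤-trans b≤c c≤1))))

  LowerSum≤∫ : ∀ {a s} → 0# ≤ a → LowerSum Ψ a 1# s → s ≤ ∫ Ψ a 1#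
  LowerSum≤∫ {a} 0≤a lower = sup-upper (LowerSum Ψ a 1#) (_ , lower)
    (1# - a , λ l → proj₂ (LowerSum-bound 0≤a ≤-refl l)) lower

  0≤∫ : ∀ {a} → 0# ≤ a → a ≤ 1# → 0# ≤ ∫ Ψ a 1#
  0≤∫ {a} 0≤a a≤1 = subst (_≤ ∫ Ψ a 1#)
    (solve 1 (λ a → :0 :* (:1 :- a) :+ :0 := :0) refl a)
    (LowerSum≤∫ 0≤a (step a≤1 (λ y y∈ → proj₁ (maps y (≤-trans 0≤a (proj₁ y∈) , proj₂ y∈))) empty))

  module Grid (b : ℕ) (1≤b : 1 ℕ.≤ b) where
    u : ℝ
    u = fromℕ b ⁻¹

    0≤u : 0# ≤ u
    0≤u = 0≤⁻¹ (0≤fromℕ b) (fromℕ≢0 1≤b)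

    bu≡1 : fromℕ b * u ≡ 1#
    bu≡1 = *-inverseʳ (fromℕ b) (fromℕ≢0 1≤b)

    -- The normalized level of a batch of b units of which k are away.
    point : ℕ → ℝ
    point k = 1# - fromℕ k / fromℕ b

    point-antitone : ∀ {k m} → k ℕ.≤ m → point m ≤ point k
    point-antitone {k} {m} k≤m = certify (gap (fromℕ-mono k≤m) ⊛ 0≤u)
      (solve 3 (λ k m u → :1 :- k :* u := (:1 :- m :* u) :+ (m :- k) :* u) refl _ _ u)

    point-0 : point 0 ≡ 1#
    point-0 = solve 1 (λ u → :1 :- :0 :* u := :1) refl u

    point-b : point b ≡ 0#
    point-b = trans (cong (λ z → 1# - z) bu≡1) (-‿inverseʳ 1#)

    point∈ : ∀ {k} → k ℕ.≤ b → point k ∈[ 0# , 1# ]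
    point∈ {k} k≤b = subst (_≤ point k) point-b (point-antitone {k} k≤b) ,
                      subst (point k ≤_) point-0 (point-antitone {0} {k} ℕ.z≤n)

    Ψ-sum : ℕ → ℝ
    Ψ-sum = sumBelow (λ l → Ψ (point l))

    Ψ-sum≤ : ∀ {k} → k ℕ.≤ b → Ψ-sum k ≤ fromℕ k
    Ψ-sum≤ {zero}  k≤b = ≤-refl
    Ψ-sum≤ {suc k} k<b = subst (Ψ-sum (suc k) ≤_) (+-comm (fromℕ k) 1#)
      (+-mono-≤ (Ψ-sum≤ (ℕ.<⇒≤ k<b)) (proj₂ (maps _ (point∈ (ℕ.<⇒≤ k<b)))))

    -- Left endpoints of the grid cells, with the first cell truncated at a.
    Ψ-sum-lower : ∀ k → k ℕ.≤ b → ∀ a → point k ≤ a → a ≤ 1# →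
                  ∃[ s ] (LowerSum Ψ a 1# s × u * Ψ-sum (suc k) ≤ u + s + (a - point k))
    -- Left endpoints account for the terms with l at least 1; the term l = 0 belongs to no cell and
    -- is paid by the summand `u`. Here `a` is 1 and only that term is present.
    Ψ-sum-lower zero k≤b a p≤a a≤1
      rewrite antisym a≤1 (subst (_≤ a) point-0 p≤a) =
      0# , empty , certify (0≤u ⊛ gap (proj₂ (maps _ (point∈ k≤b))) ⊹ gap (proj₂ (point∈ k≤b)))
        (solve 3 (λ u ψ p → u :+ :0 :+ (:1 :- p) := u :* (:0 :+ ψ) :+ (u :* (:1 :- ψ) :+ (:1 :- p)))
          refl u (Ψ (point 0)) (point 0))
    Ψ-sum-lower (suc k) k<b a p≤a a≤1 with total a (point k)
    ... | inj₁ a≤p =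
      let s , lower , bound = Ψ-sum-lower k (ℕ.<⇒≤ k<b) (point k) ≤-refl p≤1 in
      Ψ a * (point k - a) + s ,
      step a≤p (λ y (a≤y , y≤p) → monotone a y a∈ (≤-trans (proj₁ a∈) a≤y , ≤-trans y≤p p≤1) a≤y) lower ,
      certify
        (gap bound ⊹ 0≤u ⊛ gap (monotone _ a (point∈ k<b) a∈ p≤a) ⊹ gap (proj₂ (maps a a∈)) ⊛ gap p≤a)
        (solve 7 (λ u k a s ψa S ψp →
            u :+ (ψa :* ((:1 :- k :* u) :- a) :+ s) :+ (a :- (:1 :- (:1 :+ k) :* u))
            := u :* (S :+ ψp)
               :+ ((u :+ s :+ ((:1 :- k :* u) :- (:1 :- k :* u)) :- u :* S)
               :+ u :* (ψa :- ψp)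
               :+ (:1 :- ψa) :* (a :- (:1 :- (:1 :+ k) :* u))))
          refl u (fromℕ k) a s (Ψ a) (Ψ-sum (suc k)) (Ψ (point (suc k))))
      where
      a∈ : a ∈[ 0# , 1# ]
      a∈ = ≤-trans (proj₁ (point∈ k<b)) p≤a , a≤1
      p≤1 : point k ≤ 1#
      p≤1 = proj₂ (point∈ (ℕ.<⇒≤ k<b))
    -- The whole cell lies to the left of `a` and contributes no step; its term is at most `u`,
    -- which is how much `a - point k` grows.
    Ψ-sum-lower (suc k) k<b a p≤a a≤1 | inj₂ p≤a′ =
      let s , lower , bound = Ψ-sum-lower k (ℕ.<⇒≤ k<b) a p≤a′ a≤1 in
      s , lower , certify (gap bound ⊹ 0≤u ⊛ gap (proj₂ (maps _ (point∈ k<b))))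
        (solve 6 (λ u k a s S ψp →
            u :+ s :+ (a :- (:1 :- (:1 :+ k) :* u))
            := u :* (S :+ ψp)
               :+ ((u :+ s :+ (a :- (:1 :- k :* u)) :- u :* S) :+ u :* (:1 :- ψp)))
          refl u (fromℕ k) a s (Ψ-sum (suc k)) (Ψ (point (suc k))))

  -- Γ₁ and Γ₂ are the largest G with this property, for (c , κ) equal to
  -- (c₀ , 1 + γ/c₀) and (γ , 1).
  Certifies : ℝ → ℕ → ℝ → Set
  Certifies G c κ = ∀ x → x ∈[ 0# , 1# - 1# / fromℕ c ] →
    G * (1# / fromℕ c + κ * (1# - Ψ x) + ∫ Ψ (x + 1# / fromℕ c) 1#) ≤ 1# - x

  module _ {G κ : ℝ} {c : ℕ} (0≤G : 0# ≤ G) (0≤κ : 0# ≤ κ) (1≤c : 1 ℕ.≤ c)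
           (certifies : Certifies G c κ) where
    private
      v : ℝ
      v = 1# / fromℕ c

      0≤v : 0# ≤ v
      0≤v = 0≤1 ⊛ Grid.0≤u c 1≤c

      cv≡1 : fromℕ c * v ≡ 1#
      cv≡1 = trans (cong (fromℕ c *_) (*-identityˡ _)) (Grid.bu≡1 c 1≤c)

      v≤1 : v ≤ 1#
      v≤1 = subst (v ≤_) cv≡1 (certify (gap (1≤fromℕ 1≤c) ⊛ 0≤v)
        (solve 2 (λ c v → c :* v := v :+ (c :- :1) :* v) refl (fromℕ c) v))

      e : ℝ
      e = 1# - v

      e∈ : e ∈[ 0# , 1# ]
      e∈ = gap v≤1 , certify 0≤v (solve 1 (λ v → :1 := (:1 :- v) :+ v) refl v)

      -- The condition at the right end of its range, with the nonnegative integral dropped. It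
      -- yields `G ≤ 1#` and, through the chord, the bound for all levels above `e`.
      certifies-e : G * (v + κ * (1# - Ψ e)) ≤ v
      certifies-e = certify (gap (certifies e (proj₁ e∈ , ≤-refl)) ⊹ 0≤G ⊛ 0≤I)
        (solve 5 (λ G v κ ψ I → v := G :* (v :+ κ :* (:1 :- ψ)) :+
            (((:1 :- (:1 :- v)) :- G :* (v :+ κ :* (:1 :- ψ) :+ I)) :+ G :* I))
          refl G v κ (Ψ e) (∫ Ψ (e + v) 1#))
        where
        e+v≡1 : e + v ≡ 1#
        e+v≡1 = solve 1 (λ v → (:1 :- v) :+ v := :1) refl v
        0≤I : 0# ≤ ∫ Ψ (e + v) 1#
        0≤I = 0≤∫ (subst (0# ≤_) (sym e+v≡1) 0≤1) (≤-reflexive e+v≡1)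

    Certifies⇒≤1 : G ≤ 1#
    Certifies⇒≤1 = subst₂ _≤_ eq cv≡1 (*-monoˡ-≤ (0≤fromℕ c) Gv≤v)
      where
      Gv≤v : G * v ≤ v
      Gv≤v = ≤-trans (*-monoˡ-≤ 0≤G (certify (0≤κ ⊛ gap (proj₂ (maps e e∈))) refl)) certifies-e
      eq : fromℕ c * (G * v) ≡ G
      eq = trans (solve 3 (λ c G v → c :* (G :* v) := G :* (c :* v)) refl (fromℕ c) G v)
             (trans (cong (G *_) cv≡1) (*-identityʳ G))

    module _ {b : ℕ} (c≤b : c ℕ.≤ b) where
      open Grid b (ℕ.≤-trans 1≤c c≤b)

      private
        b# c# : ℝ
        b# = fromℕ b
        c# = fromℕ c

        u≤v : u ≤ v
        u≤v = subst₂ _≤_ eqˡ eqʳ (*-monoˡ-≤ (0≤u ⊛ 0≤v) (fromℕ-mono c≤b))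
          where
          eqˡ : (u * v) * c# ≡ u
          eqˡ = trans (solve 3 (λ u v c → (u :* v) :* c := u :* (c :* v)) refl u v c#)
                  (trans (cong (u *_) cv≡1) (*-identityʳ u))
          eqʳ : (u * v) * b# ≡ v
          eqʳ = trans (solve 3 (λ u v b → (u :* v) :* b := v :* (b :* u)) refl u v b#)
                  (trans (cong (v *_) bu≡1) (*-identityʳ v))

        -- The certificate at `x = point (suc k)`, multiplied by `b`. Since `x + u` is `point k`,
        -- the errors `u + (x + v - point k)` of the grid estimate add up to exactly `v`, the
        -- summand 1/c of the certificate; and `u ≤ v` places the lower limit `x + v` at or beyond
        -- `point k`, as the estimate demands.
        large : ∀ k → suc k ℕ.≤ b → point (suc k) ≤ e →
                G * (b# * κ * (1# - Ψ (point (suc k))) + Ψ-sum (suc k)) ≤ fromℕ (suc k)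
        large k k<b x≤e = subst₂ _≤_ (sym eqˡ) eqʳ scaled
          where
          K x S I : ℝ
          K = fromℕ (suc k)
          x = point (suc k)
          S = Ψ-sum (suc k)
          I = ∫ Ψ (x + v) 1#
          x∈ : x ∈[ 0# , 1# ]
          x∈ = point∈ k<b
          p≤a : point k ≤ x + v
          p≤a = certify (gap u≤v)
            (solve 3 (λ k u v → (:1 :- (:1 :+ k) :* u) :+ v := (:1 :- k :* u) :+ (v :- u))
              refl (fromℕ k) u v)
          a≤1 : x + v ≤ 1#
          a≤1 = certify (gap x≤e)
            (solve 2 (λ x v → :1 := (x :+ v) :+ ((:1 :- v) :- x)) refl x v)
          lowerSum : ∃[ s ] (LowerSum Ψ (x + v) 1# s × u * S ≤ u + s + (x + v - point k))
          lowerSum = Ψ-sum-lower k (ℕ.<⇒≤ k<b) (x + v) p≤a a≤1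
          s : ℝ
          s = proj₁ lowerSum
          s≤I : s ≤ I
          s≤I = LowerSum≤∫ (proj₁ x∈ ⊹ 0≤v) (proj₁ (proj₂ lowerSum))
          scaled : b# * (G * (κ * (1# - Ψ x) + u * S)) ≤ b# * (1# - x)
          scaled = *-monoˡ-≤ (0≤fromℕ b) (≤-trans
            (*-monoˡ-≤ 0≤G (certify (gap (proj₂ (proj₂ lowerSum)) ⊹ gap s≤I)
              (solve 7 (λ k u v S κψ I s →
                  v :+ κψ :+ I := (κψ :+ u :* S)
                    :+ ((u :+ s :+ (((:1 :- (:1 :+ k) :* u) :+ v) :- (:1 :- k :* u)) :- u :* S)
                    :+ (I :- s)))
                refl (fromℕ k) u v S (κ * (1# - Ψ x)) I s)))
            (certifies x (proj₁ x∈ , x≤e)))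
          eqˡ : G * (b# * κ * (1# - Ψ x) + S) ≡ b# * (G * (κ * (1# - Ψ x) + u * S))
          eqˡ = trans
            (cong (λ z → G * (b# * κ * (1# - Ψ x) + z))
              (trans (sym (*-identityˡ S)) (cong (_* S) (sym bu≡1))))
            (solve 6 (λ G b κ ψ u S → G :* (b :* κ :* (:1 :- ψ) :+ (b :* u) :* S)
                := b :* (G :* (κ :* (:1 :- ψ) :+ u :* S))) refl G b# κ (Ψ x) u S)
          eqʳ : b# * (1# - x) ≡ K
          eqʳ = trans
            (solve 3 (λ b K u → b :* (:1 :- (:1 :- K :* u)) := K :* (b :* u)) refl b# K u)
            (trans (cong (K *_) bu≡1) (*-identityʳ K))

        -- The point lies outside the range of the minimum, so Ψ is compared
        -- with its chord from e to 1.
        small : ∀ k → k ℕ.≤ b → e ≤ point k →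
                G * (b# * κ * (1# - Ψ (point k)) + Ψ-sum k) ≤ fromℕ k
        small k k≤b e≤x = ≤-trans
          (certify
            (0≤G ⊛ (0≤fromℕ b ⊛ 0≤κ) ⊛ gap chord ⊹ 0≤G ⊛ gap (Ψ-sum≤ k≤b))
            (solve 7 (λ G bκ K S w ψe ψx →
                G :* (bκ :* (w :* (:1 :- ψe)) :+ K) := G :* (bκ :* (:1 :- ψx) :+ S)
                  :+ (G :* bκ :* (w :* (:1 :- ψe) :- (:1 :- ψx)) :+ G :* (K :- S)))
              refl G (b# * κ) K (Ψ-sum k) w (Ψ e) (Ψ x)))
          (subst₂ _≤_ eqˡ eqʳ (*-monoˡ-≤ (0≤fromℕ c ⊛ 0≤fromℕ k) certifies-e))
          where
          K x w : ℝ
          K = fromℕ k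
          x = point k
          -- The weight placing `x` on the segment from 1 to `e`: the distances to 1 are
          -- `1 - x = K * u` and `1 - e = 1/c`.
          w = K * u * c#
          Ku≤v : K * u ≤ v
          Ku≤v = certify (gap e≤x)
            (solve 2 (λ v d → v := d :+ ((:1 :- d) :- (:1 :- v))) refl v (K * u))
          w∈ : w ∈[ 0# , 1# ]
          w∈ = (0≤fromℕ k ⊛ 0≤u) ⊛ 0≤fromℕ c ,
            subst₂ _≤_ (*-comm c# (K * u)) cv≡1 (*-monoˡ-≤ (0≤fromℕ c) Ku≤v)
          combination≡x : w * e + (1# - w) * 1# ≡ x
          combination≡x = trans
            (solve 3 (λ d c v → (d :* c) :* (:1 :- v) :+ (:1 :- d :* c) :* :1 := :1 :- d :* (c :* v))
              refl (K * u) c# v)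
            (cong (λ z → 1# - z) (trans (cong (K * u *_) cv≡1) (*-identityʳ (K * u))))
          chord : 1# - Ψ x ≤ w * (1# - Ψ e)
          chord = certify
            (gap (subst₂ _≤_ (cong (λ z → w * Ψ e + (1# - w) * z) at-1) (cong Ψ combination≡x)
              (concave e 1# w e∈ (0≤1 , ≤-refl) w∈)))
            (solve 3 (λ w ψe ψx → w :* (:1 :- ψe) :=
                (:1 :- ψx) :+ (ψx :- (w :* ψe :+ (:1 :- w) :* :1))) refl w (Ψ e) (Ψ x))
          eqˡ : (c# * K) * (G * (v + κ * (1# - Ψ e))) ≡ G * (b# * κ * (w * (1# - Ψ e)) + K)
          eqˡ = trans
            (solve 6 (λ c K G v κ y → (c :* K) :* (G :* (v :+ κ :* y))
                := G :* (:1 :* κ :* (K :* c :* y) :+ K :* (c :* v))) refl c# K G v κ (1# - Ψ e))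
            (trans
              (cong₂ (λ p q → G * (p * κ * (K * c# * (1# - Ψ e)) + K * q)) (sym bu≡1) cv≡1)
              (solve 7 (λ b u κ K c y G → G :* ((b :* u) :* κ :* (K :* c :* y) :+ K :* :1)
                  := G :* (b :* κ :* ((K :* u :* c) :* y) :+ K))
                refl b# u κ K c# (1# - Ψ e) G))
          eqʳ : (c# * K) * v ≡ K
          eqʳ = trans (solve 3 (λ c K v → (c :* K) :* v := K :* (c :* v)) refl c# K v)
                  (trans (cong (K *_) cv≡1) (*-identityʳ K))

      -- The form in which the choice of Γ is used. The factor `b# * κ` bounds the number of slots,
      -- because the same `k` sales may have to pay for one loss in every slot. For `k = 0` the
      -- level is 1, above the range of the minimum.
      Certifies⇒batch-bound : ∀ k → k ℕ.≤ b →
        G * (b# * κ * (1# - Ψ (point k)) + Ψ-sum k) ≤ fromℕ k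
      Certifies⇒batch-bound zero k≤b = small 0 k≤b (subst (e ≤_) (sym point-0) (proj₂ e∈))
      Certifies⇒batch-bound (suc k) k<b with total (point (suc k)) e
      ... | inj₁ x≤e = large k k<b x≤e
      ... | inj₂ e≤x = small (suc k) k<b e≤x

  -- The denominator is abstract so that one argument serves both minima: that of `Γ₂` has the
  -- required shape only after inserting a factor 1.
  module _ {κ : ℝ} {c : ℕ} (0≤κ : 0# ≤ κ) (1≤c : 1 ℕ.≤ c) {D : ℝ → ℝ}
           (D≡ : ∀ x → D x ≡ 1# / fromℕ c + κ * (1# - Ψ x) + ∫ Ψ (x + 1# / fromℕ c) 1#) where
    private
      v : ℝ
      v = 1# / fromℕ c

      0≤v : 0# ≤ v
      0≤v = 0≤1 ⊛ Grid.0≤u c 1≤c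

      v≢0 : v ≢ 0#
      v≢0 v≡0 = 0≢1 (trans (sym (zeroʳ (fromℕ c)))
        (trans (cong (fromℕ c *_) (sym v≡0))
          (trans (cong (fromℕ c *_) (*-identityˡ _)) (Grid.bu≡1 c 1≤c))))

      module _ {x : ℝ} (x∈ : x ∈[ 0# , 1# - v ]) where
        x+v≤1 : x + v ≤ 1#
        x+v≤1 = certify (gap (proj₂ x∈))
          (solve 2 (λ x v → :1 := (x :+ v) :+ ((:1 :- v) :- x)) refl x v)

        x≤1 : x ≤ 1#
        x≤1 = certify (gap (proj₂ x∈) ⊹ 0≤v)
          (solve 2 (λ x v → :1 := x :+ (((:1 :- v) :- x) :+ v)) refl x v)

        -- Keeps the denominator away from 0, where the inverse is unconstrained.
        v≤D : v ≤ D x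
        v≤D = subst (v ≤_) (sym (D≡ x)) (certify
          (0≤κ ⊛ gap (proj₂ (maps x (proj₁ x∈ , x≤1))) ⊹ 0≤∫ (proj₁ x∈ ⊹ 0≤v) x+v≤1)
          (solve 3 (λ v y I → v :+ y :+ I := v :+ (y :+ I)) refl v _ _))

        D≢0 : D x ≢ 0#
        D≢0 D≡0 = v≢0 (antisym (subst (v ≤_) D≡0 v≤D) 0≤v)

        0≤D : 0# ≤ D x
        0≤D = ≤-trans 0≤v v≤D

        0≤ratio : 0# ≤ (1# - x) / D x
        0≤ratio = gap x≤1 ⊛ 0≤⁻¹ 0≤D D≢0

    ratio : ℝ → ℝ
    ratio x = (1# - x) / D x

    0≤1-v : 0# ≤ 1# - v
    0≤1-v = gap (subst₂ _≤_ (*-identityˡ v)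
      (trans (cong (fromℕ c *_) (*-identityˡ _)) (Grid.bu≡1 c 1≤c))
      (subst₂ _≤_ (*-comm v 1#) (*-comm v (fromℕ c)) (*-monoˡ-≤ 0≤v (1≤fromℕ 1≤c))))

    0≤min-ratio : 0# ≤ min[ 0# , 1# - v ] ratio
    0≤min-ratio = 0≤min 0≤1-v (λ x x∈ → 0≤ratio x∈)

    ≤min-ratio⇒Certifies : ∀ {G} → G ≤ min[ 0# , 1# - v ] ratio → Certifies G c κ
    ≤min-ratio⇒Certifies {G} G≤ x x∈ = subst₂ _≤_
      (trans (*-comm (D x) G) (cong (G *_) (D≡ x)))
      (trans (solve 3 (λ d y z → d :* (y :* z) := y :* (d :* z)) refl (D x) (1# - x) (D x ⁻¹))
        (trans (cong ((1# - x) *_) (*-inverseʳ (D x) (D≢0 x∈))) (*-identityʳ _)))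
      (*-monoˡ-≤ (0≤D x∈) (≤-trans G≤ (min≤ 0≤1-v (λ y y∈ → 0≤ratio y∈) x x∈)))

  module _ {γ c₀ : ℕ} (1≤γ : 1 ℕ.≤ γ) (1≤c₀ : 1 ℕ.≤ c₀) where
    open Bound Ψ γ c₀

    0≤κ₁ : 0# ≤ 1# + γ/c₀
    0≤κ₁ = 0≤1 ⊹ 0≤fromℕ γ ⊛ Grid.0≤u c₀ 1≤c₀

    private
      drop-1* : ∀ x → 1/γ + (1# - Ψ x) + ∫ Ψ (x + 1/γ) 1# ≡ 1/γ + 1# * (1# - Ψ x) + ∫ Ψ (x + 1/γ) 1#
      drop-1* x = cong (λ z → 1/γ + z + ∫ Ψ (x + 1/γ) 1#) (sym (*-identityˡ _))

    0≤Γ : 0# ≤ Γ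
    0≤Γ = ⊓-glb (0≤min-ratio 0≤κ₁ 1≤c₀ (λ _ → refl)) (0≤min-ratio 0≤1 1≤γ drop-1*)

    Γ-certifies₁ : Certifies Γ c₀ (1# + γ/c₀)
    Γ-certifies₁ = ≤min-ratio⇒Certifies 0≤κ₁ 1≤c₀ (λ _ → refl) (x⊓y≤x _ _)

    Γ-certifies₂ : Certifies Γ γ 1#
    Γ-certifies₂ = ≤min-ratio⇒Certifies 0≤1 1≤γ drop-1* (x⊓y≤y _ _)

-- Batches and levels along a sample path of BIB.

module Comparison (F : CompleteOrderedField) where
  open Assortment F
  open OrderedField F

  module Run {n : ℕ} (products : Products n) (𝒮 : Assortments n)
             (φ : ℕ → ChoiceModel 𝒮) (ξ : ℕ → Fin n → ℕ)
             (Ψ : ℝ → ℝ) (isPenalty : IsPenalty Ψ)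
             (γ c₀ : ℕ) (1≤γ : 1 ℕ.≤ γ) (1≤c₀ : 1 ℕ.≤ c₀)
             (c₀≤ : ∀ i → c₀ ℕ.≤ Products.inventory products i)
             (oracle : Market.Batching.Oracle products 𝒮 φ ξ γ)
             (exact : Market.Batching.IsExactOracle products 𝒮 φ ξ γ oracle)
             (rule : Market.Batching.BatchRule products 𝒮 φ ξ γ)
             (fullest : Market.Batching.SelectsFullest products 𝒮 φ ξ γ rule) where
    open Market products 𝒮 φ ξ
    open Batching γ
    open Algorithm Ψ oracle rule
    open IsPenalty isPenalty
    open PenaltyBound F Ψ isPenalty
    open Bound Ψ γ c₀ using (Γ; γ/c₀)

    -- The fewer than γ units of the charging batch are represented by
    -- additional slots of batch 0; this causes the term γ/c₀ of Γ₁.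
    slots : Fin n → ℕ → ℕ
    slots i zero    = inventory i ℕ.+ γ
    slots i (suc j) = γ

    1≤slots : ∀ i j → 1 ℕ.≤ slots i j
    1≤slots i zero    = ℕ.≤-trans (inventory-positive i) (ℕ.m≤m+n _ _)
    1≤slots i (suc j) = 1≤γ

    1≤batchSize : ∀ i j → 1 ℕ.≤ batchSize i j
    1≤batchSize i zero    = inventory-positive i
    1≤batchSize i (suc j) = 1≤γ

    module BatchGrid (i : Fin n) (j : ℕ) = Grid (batchSize i j) (1≤batchSize i j)
    open BatchGrid using (point; Ψ-sum; point∈; point-antitone)

    private
      0≤G : 0# ≤ Γ
      0≤G = 0≤Γ 1≤γ 1≤c₀

    Γ≤1 : Γ ≤ 1#
    Γ≤1 = Certifies⇒≤1 0≤G 0≤1 1≤γ (Γ-certifies₂ 1≤γ 1≤c₀)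

    -- Batch 0 has b units with b at least c₀, so γ is at most b γ/c₀ and its b + γ slots number at
    -- most b (1 + γ/c₀). Every other batch has as many slots as units, which is the case of factor
    -- 1 in `Γ₂`.
    batch-bound : ∀ i j k → k ℕ.≤ batchSize i j →
      Γ * (fromℕ (slots i j) * (1# - Ψ (point i j k)) + Ψ-sum i j k) ≤ fromℕ k
    batch-bound i zero k k≤b = ≤-trans
      (*-monoˡ-≤ 0≤G (+-mono-≤
        (subst₂ _≤_ (*-comm _ _) (*-comm _ _)
          (*-monoˡ-≤ (gap (proj₂ (maps _ (point∈ i zero k≤b)))) slots≤))
        ≤-refl))
      (Certifies⇒batch-bound 0≤G (0≤κ₁ 1≤γ 1≤c₀) 1≤c₀ (Γ-certifies₁ 1≤γ 1≤c₀) (c₀≤ i) k k≤b)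
      where
      b u₀ g : ℝ
      b = fromℕ (inventory i)
      u₀ = fromℕ c₀ ⁻¹
      g = fromℕ γ
      slots≤ : fromℕ (inventory i ℕ.+ γ) ≤ b * (1# + γ/c₀)
      slots≤ = subst (_≤ b * (1# + γ/c₀)) (sym (fromℕ-+ (inventory i) γ)) (certify
        ((gap (fromℕ-mono (c₀≤ i)) ⊛ Grid.0≤u c₀ 1≤c₀) ⊛ 0≤fromℕ γ)
        (trans
          (solve 4 (λ b g u c → b :* (:1 :+ g :* u) := (b :+ (c :* u) :* g) :+ ((b :- c) :* u) :* g)
            refl b g u₀ (fromℕ c₀))
          (cong (λ z → b + z + (b - fromℕ c₀) * u₀ * g)
            (trans (cong (_* g) (Grid.bu≡1 c₀ 1≤c₀)) (*-identityˡ g)))))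
    batch-bound i (suc j) k k≤b = subst
      (λ z → Γ * (z * (1# - Ψ (point i (suc j) k)) + Ψ-sum i (suc j) k) ≤ fromℕ k)
      (*-identityʳ (fromℕ γ))
      (Certifies⇒batch-bound 0≤G 0≤1 1≤γ (Γ-certifies₂ 1≤γ 1≤c₀) ℕ.≤-refl k k≤b)

    top : BatchHistory → Fin n → ℝ
    top h i = foldr₁ _⊔_ (levels h i)

    level≤top : ∀ h i j → levels h i j ≤ top h i
    level≤top h i = foldr₁-dominates _≤_ ≤-refl ≤-trans x≤x⊔y x≤y⊔x (levels h i)

    top≡ : ∀ h i → top h i ≡ levels h i (rule h i)
    top≡ h i = antisym
      (foldr₁-preserves (_≤ levels h i (rule h i)) ⊔-lub (levels h i) (fullest h i))
      (level≤top h i (rule h i))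

    ψ : BatchHistory → Fin n → ℝ
    ψ h i = Ψ (top h i)

    window : Fin n → ℕ
    window i = duration i ℕ.∸ 1

    sale? : ∀ i j (e : Maybe (Fin n × ℕ)) → Dec (e ≡ just (i , j))
    sale? i j e = Maybe.≡-dec (Product.≡-dec Fin._≟_ ℕ._≟_) e (just (i , j))

    -- Every sale follows `rule` and finds a unit in stock. BIB itself makes no such check, so this
    -- is an invariant of the runs, maintained by `offered-available`.
    data Valid : BatchHistory → Set where
      []   : Valid []
      none : ∀ {h} → Valid h → Valid (nothing ∷ h)
      sale : ∀ {h} i → Valid h →
             awayFrom i (toℕ (rule h i)) h ℕ.< batchSize i (toℕ (rule h i)) →
             Valid (just (i , toℕ (rule h i)) ∷ h)

    -- Keeps the levels in the unit interval, outside of which `Ψ` is unconstrained.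
    awayFrom≤batchSize : ∀ {h} → Valid h → ∀ i j → awayFrom i j h ℕ.≤ batchSize i j
    awayFrom≤batchSize [] i j with window i
    ... | zero  = ℕ.z≤n
    ... | suc _ = ℕ.z≤n
    awayFrom≤batchSize (none {h} valid) i j = ℕ.≤-trans
      (count-take-reject (sale? i j) (window i) h λ ()) (awayFrom≤batchSize valid i j)
    awayFrom≤batchSize (sale {h} i′ valid away<) i j with sale? i j (just (i′ , toℕ (rule h i′)))
    ... | yes refl = ℕ.≤-trans (count-take-∷ (sale? i j) (window i) _ h) away<
    ... | no e≢    = ℕ.≤-trans (count-take-reject (sale? i j) (window i) h e≢)
      (awayFrom≤batchSize valid i j)

    top∈ : ∀ {h} → Valid h → ∀ i → top h i ∈[ 0# , 1# ]
    top∈ {h} valid i = subst (_∈[ 0# , 1# ]) (sym (top≡ h i))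
      (point∈ i (toℕ (rule h i)) (awayFrom≤batchSize valid i (toℕ (rule h i))))

    ψ∈ : ∀ {h} → Valid h → ∀ i → ψ h i ∈[ 0# , 1# ]
    ψ∈ valid i = maps _ (top∈ valid i)

    -- What BIB's sales contribute, and what the last window contributes.

    gain : BatchHistory → Fin n → ℝ
    gain h i = 1# - Γ * ψ h i

    0≤gain : ∀ {h} → Valid h → ∀ i → 0# ≤ gain h i
    0≤gain {h} valid i = subst (0# ≤_)
      (solve 2 (λ G p → (:1 :- G) :+ G :* (:1 :- p) := :1 :- G :* p) refl Γ (ψ h i))
      (gap Γ≤1 ⊹ 0≤G ⊛ gap (proj₂ (ψ∈ valid i)))

    earned : Fin n → ℕ → BatchHistory → ℝ
    earned i j []      = 0#
    earned i j (e ∷ h) = when (sale? i j e) (gain h i) + earned i j h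

    recent : Fin n → ℕ → ℕ → BatchHistory → ℝ
    recent i j zero    h       = 0#
    recent i j (suc m) []      = 0#
    recent i j (suc m) (e ∷ h) = when (sale? i j e) (gain h i) + recent i j m h

    valid-tail : ∀ {e h} → Valid (e ∷ h) → Valid h
    valid-tail (none valid)     = valid
    valid-tail (sale _ valid _) = valid

    0≤earned : ∀ i j {h} → Valid h → 0# ≤ earned i j h
    0≤earned i j {[]}    valid = ≤-refl
    0≤earned i j {e ∷ h} valid =
      0≤when (sale? i j e) (0≤gain (valid-tail valid) i) ⊹ 0≤earned i j (valid-tail valid)

    -- As `m` is at most the window, the `k` earlier sales counted are all still away when the next
    -- one is made. That sale comes from the fullest batch, so its `ψ` is `Ψ` at the level of batch
    -- `j` itself, hence at most `Ψ (point i j k)`: the next term of `Ψ-sum`.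
    recent-lower : ∀ i j {h} → Valid h → ∀ m → m ℕ.≤ window i →
      let k = count (sale? i j) (take m h) in fromℕ k - Γ * Ψ-sum i j k ≤ recent i j m h
    recent-lower i j {h} valid zero m≤ = ≤-reflexive (solve 1 (λ G → :0 :- G :* :0 := :0) refl Γ)
    recent-lower i j {[]} valid (suc m) m≤ = ≤-reflexive (solve 1 (λ G → :0 :- G :* :0 := :0) refl Γ)
    recent-lower i j {e ∷ h} valid (suc m) m≤ = step-case valid (sale? i j e)
      where
      k : ℕ
      k = count (sale? i j) (take m h)
      m≤w : m ℕ.≤ window i
      m≤w = ℕ.<⇒≤ m≤
      Bound : ℕ → ℝ → Set
      Bound k x = fromℕ k - Γ * Ψ-sum i j k ≤ x + recent i j m h
      step-case : ∀ {e} → Valid (e ∷ h) → Dec (e ≡ just (i , j)) →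
                  Bound (count (sale? i j) (e ∷ take m h)) (when (sale? i j e) (gain h i))
      step-case {e} valid (no e≢) = subst₂ Bound (sym (count-reject (sale? i j) e≢))
        (sym (when-no (sale? i j e) e≢))
        (≤-trans (recent-lower i j (valid-tail valid) m m≤w) (≤-reflexive (sym (+-identityˡ _))))
      step-case (sale i valid _) (yes refl) = subst₂ Bound
        (sym (count-accept (sale? i j) refl))
        (sym (when-yes (sale? i j (just (i , j))) refl))
        (certify (gap (recent-lower i j valid m m≤w) ⊹ 0≤G ⊛ gap ψ≤)
          (solve 6 (λ G p q K S r →
              (:1 :- G :* p) :+ r :=
              ((:1 :+ K) :- G :* (S :+ q)) :+ ((r :- (K :- G :* S)) :+ G :* (q :- p)))
            refl Γ (ψ h i) (Ψ (point i j k)) (fromℕ k) (Ψ-sum i j k) (recent i j m h)))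
        where
        k≤away : k ℕ.≤ awayFrom i j h
        k≤away = count-take-mono (sale? i j) m≤w h
        ψ≤ : ψ h i ≤ Ψ (point i j k)
        ψ≤ = monotone _ _ (top∈ valid i)
          (point∈ i j (ℕ.≤-trans k≤away (awayFrom≤batchSize valid i j)))
          (subst (_≤ point i j k) (sym (top≡ h i)) (point-antitone i j k≤away))

    -- Readiness of batch `j` makes its level count in the maximum `top`, so `1 - ψ` is at most the
    -- loss at the level of batch `j`, which `batch-bound` weighs against the sales that lowered it.
    window-bound : ∀ i j {h} → Valid h → j ℕ.< ready i (length h) →
      fromℕ (slots i j) * (Γ * (1# - ψ h i)) ≤ recent i j (window i) h
    window-bound i j {h} valid j<ready = ≤-trans
      (certify
        (gap (batch-bound i j k (awayFrom≤batchSize valid i j)) ⊹ (0≤fromℕ (slots i j) ⊛ 0≤G) ⊛ gap ψ≥)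
        (solve 6 (λ G m p q K S →
            K :- G :* S := m :* (G :* (:1 :- q)) :+
              ((K :- G :* (m :* (:1 :- p) :+ S)) :+ m :* G :* (q :- p)))
          refl Γ (fromℕ (slots i j)) (Ψ (point i j k)) (ψ h i) (fromℕ k) (Ψ-sum i j k)))
      (recent-lower i j valid (window i) ℕ.≤-refl)
      where
      k : ℕ
      k = awayFrom i j h
      ψ≥ : Ψ (point i j k) ≤ ψ h i
      ψ≥ = monotone _ _ (point∈ i j (awayFrom≤batchSize valid i j)) (top∈ valid i)
        (subst (λ z → point i z (awayFrom i z h) ≤ top h i) (Fin.toℕ-fromℕ< j<ready)
          (level≤top h i (fromℕ< j<ready)))

    -- Slots, the assignment of the benchmark's sales, and the pathwise inequality.

    private instance
      γ-nonZero : NonZero γ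
      γ-nonZero = ℕ.>-nonZero 1≤γ

    -- Truncated subtraction: slots 0, …, inventory i + γ - 1 belong to batch 0.
    batchOf : Fin n → ℕ → ℕ
    batchOf i k = (k ℕ.∸ inventory i) ℕ./ γ

    firstSlot : Fin n → ℕ → ℕ
    firstSlot i zero    = 0
    firstSlot i (suc j) = inventory i ℕ.+ suc j ℕ.* γ

    batchOf-slots : ∀ i {k j} → batchOf i k ≡ j →
                    firstSlot i j ℕ.≤ k × k ℕ.< firstSlot i j ℕ.+ slots i j
    batchOf-slots i {k} {j} refl = go j refl
      where
      c r : ℕ
      c = inventory i
      r = k ℕ.∸ c
      r< : ∀ q → r ℕ./ γ ≡ q → r ℕ.< q ℕ.* γ ℕ.+ γ
      r< q refl = subst₂ ℕ._<_ (sym (ℕ.m≡m%n+[m/n]*n r γ)) (ℕ.+-comm γ _)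
        (ℕ.+-monoˡ-< (r ℕ./ γ ℕ.* γ) (ℕ.m%n<n r γ))
      ≤r : ∀ q → r ℕ./ γ ≡ q → q ℕ.* γ ℕ.≤ r
      ≤r q refl = ℕ.m/n*n≤m r γ
      go : ∀ q → r ℕ./ γ ≡ q → firstSlot i q ℕ.≤ k × k ℕ.< firstSlot i q ℕ.+ slots i q
      go zero    eq = ℕ.z≤n , ℕ.≤-<-trans (ℕ.m≤n+m∸n k c) (ℕ.+-monoʳ-< c (r< 0 eq))
      go (suc q) eq =
        subst (firstSlot i (suc q) ℕ.≤_) c+r≡k (ℕ.+-monoʳ-≤ c (≤r (suc q) eq)) ,
        subst₂ ℕ._<_ c+r≡k (sym (ℕ.+-assoc c _ γ)) (ℕ.+-monoʳ-< c (r< (suc q) eq))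
        where
        0<r : 0 ℕ.< r
        0<r = ℕ.≤-trans (ℕ.≤-trans 1≤γ (ℕ.m≤m+n γ (q ℕ.* γ))) (≤r (suc q) eq)
        c+r≡k : c ℕ.+ r ≡ k
        c+r≡k = ℕ.m+[n∸m]≡n {c} {k} (ℕ.<⇒≤ (ℕ.m∸n≢0⇒n<m {k} {c} (ℕ.>⇒≢ 0<r)))

    Slots : Set
    Slots = List (Maybe ℕ)

    -- The benchmark's sales of product i are assigned to slots.  A slot of
    -- batch j is only used once that batch is ready, and the uses of any slot
    -- are at least duration i periods apart.
    data Assigned (i : Fin n) : History → Slots → BatchHistory → Set where
      []   : Assigned i [] [] []
      none : ∀ {a as s h e} → a ≢ just i → Assigned i as s h →
             Assigned i (a ∷ as) (nothing ∷ s) (e ∷ h)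
      sale : ∀ {as s h e} k → Assigned i as s h → just k ∉ take (window i) s →
             batchOf i k ℕ.< ready i (length h) →
             Assigned i (just i ∷ as) (just k ∷ s) (e ∷ h)

    chosen? : ∀ (a : Maybe (Fin n)) i → Dec (a ≡ just i)
    chosen? a i = Maybe.≡-dec Fin._≟_ a (just i)

    slot? : ∀ (a : Maybe ℕ) k → Dec (a ≡ just k)
    slot? a k = Maybe.≡-dec ℕ._≟_ a (just k)

    slotLoss : Fin n → ℕ → Slots → BatchHistory → ℝ
    slotLoss i k (a ∷ s) (e ∷ h) = when (slot? a k) (1# - ψ h i) + slotLoss i k s h
    slotLoss i k _       _       = 0#

    -- The periods of the windows preceding the uses of a slot are disjoint,
    -- so window-bound can be summed over them.
    slot-bound : ∀ i k {as s h} → Valid h → Assigned i as s h → ∀ m → just k ∉ take m s →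
      fromℕ (slots i (batchOf i k)) * (Γ * slotLoss i k s h) + recent i (batchOf i k) m h
        ≤ earned i (batchOf i k) h
    slot-bound i k valid [] zero k∉ =
      ≤-reflexive (solve 2 (λ G M → M :* (G :* :0) :+ :0 := :0) refl Γ _)
    slot-bound i k valid [] (suc m) k∉ =
      ≤-reflexive (solve 2 (λ G M → M :* (G :* :0) :+ :0 := :0) refl Γ _)
    slot-bound i k {as = a ∷ _} {s = b ∷ s} {h = e ∷ h} valid assigned m k∉ = go m assigned k∉
      where
      j : ℕ
      j = batchOf i k
      M L E w : ℝ
      M = fromℕ (slots i j)
      L = slotLoss i k s h
      E = earned i j h
      w = when (sale? i j e) (gain h i)
      0≤w : 0# ≤ w
      0≤w = 0≤when (sale? i j e) (0≤gain (valid-tail valid) i)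
      Goal : ℕ → ℝ → Set
      Goal m x = M * (Γ * (x + L)) + recent i j m (e ∷ h) ≤ w + E

      unused : ∀ {as} → Assigned i as s h → ∀ m {b} → just k ∉ take m (b ∷ s) → b ≢ just k →
               Goal m (when (slot? b k) (1# - ψ h i))
      unused assigned zero {b} k∉ b≢ = subst (Goal zero) (sym (when-no (slot? b k) b≢))
        (certify (gap (slot-bound i k (valid-tail valid) assigned zero λ ()) ⊹ 0≤w)
          (solve 5 (λ M G L w E → w :+ E := (M :* (G :* (:0 :+ L)) :+ :0) :+
            ((E :- (M :* (G :* L) :+ :0)) :+ w)) refl M Γ L w E))
      unused assigned (suc m) {b} k∉ b≢ = subst (Goal (suc m)) (sym (when-no (slot? b k) b≢))
        (certify (gap (slot-bound i k (valid-tail valid) assigned m (k∉ ∘ there)))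
          (solve 6 (λ M G L w E r → w :+ E := (M :* (G :* (:0 :+ L)) :+ (w :+ r)) :+
            (E :- (M :* (G :* L) :+ r))) refl M Γ L w E (recent i j m h)))

      -- At a use the reserve `recent` of a full window is spent on the loss. The freshness of the
      -- slot is what allows the induction to restart with `m = window i`, setting that reserve
      -- aside.
      used : ∀ {as} → Assigned i as s h → just k ∉ take (window i) s → j ℕ.< ready i (length h) →
             Goal zero (1# - ψ h i)
      used assigned fresh ready = certify
        (gap (slot-bound i k (valid-tail valid) assigned (window i) fresh)
          ⊹ gap (window-bound i j (valid-tail valid) ready) ⊹ 0≤w)
        (solve 7 (λ M G L w E r g → w :+ E := (M :* (G :* (g :+ L)) :+ :0) :+
          ((E :- (M :* (G :* L) :+ r)) :+ (r :- M :* (G :* g)) :+ w))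
          refl M Γ L w E (recent i j (window i) h) (1# - ψ h i))

      by-slot : ∀ m {as k′} → Dec (k′ ≡ k) → Assigned i as s h → just k′ ∉ take (window i) s →
                batchOf i k′ ℕ.< ready i (length h) → just k ∉ take m (just k′ ∷ s) →
                Goal m (when (slot? (just k′) k) (1# - ψ h i))
      by-slot zero (yes refl) assigned fresh ready k∉ =
        subst (Goal zero) (sym (when-yes (slot? (just k) k) refl)) (used assigned fresh ready)
      by-slot (suc m) (yes refl) assigned fresh ready k∉ = contradiction (here refl) k∉
      by-slot m (no k′≢k) assigned fresh ready k∉ = unused assigned m k∉ (k′≢k ∘ Maybe.just-injective)

      go : ∀ m {a b} → Assigned i (a ∷ _) (b ∷ s) (e ∷ h) → just k ∉ take m (b ∷ s) →
           Goal m (when (slot? b k) (1# - ψ h i))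
      go m (none _ assigned) k∉ = unused assigned m k∉ λ ()
      go m (sale k′ assigned fresh ready) k∉ = by-slot m (k′ ℕ.≟ k) assigned fresh ready k∉

    totalLoss : Fin n → History → BatchHistory → ℝ
    totalLoss i (a ∷ as) (e ∷ h) = when (chosen? a i) (1# - ψ h i) + totalLoss i as h
    totalLoss i _        _       = 0#

    totalEarned : Fin n → BatchHistory → ℝ
    totalEarned i []      = 0#
    totalEarned i (e ∷ h) = when (chosen? (Maybe.map proj₁ e) i) (gain h i) + totalEarned i h

    slots-bounded : ∀ (s : Slots) → ∃[ K ] (∀ {k} → just k ∈ s → k ℕ.< K)
    slots-bounded []      = 0 , λ ()
    slots-bounded (nothing ∷ s) = proj₁ (slots-bounded s) , λ { (there k∈) → proj₂ (slots-bounded s) k∈ }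
    slots-bounded (just k ∷ s) = suc k ℕ.⊔ proj₁ (slots-bounded s) , λ where
      (here refl) → ℕ.m≤m⊔n (suc k) (proj₁ (slots-bounded s))
      (there k∈)  → ℕ.m≤n⇒m≤o⊔n (suc k) (proj₂ (slots-bounded s) k∈)

    totalLoss≤ : ∀ i {as s h} → Valid h → Assigned i as s h → ∀ K → (∀ {k} → just k ∈ s → k ℕ.< K) →
                 totalLoss i as h ≤ sum {K} (λ k → slotLoss i (toℕ k) s h)
    totalLoss≤ i valid [] K bounded = sum-nonNeg {K} λ _ → ≤-refl
    totalLoss≤ i {a ∷ as} {b ∷ s} {e ∷ h} valid assigned K bounded = go assigned bounded
      where
      g : ℝ
      g = 1# - ψ h i
      0≤g : 0# ≤ g
      0≤g = gap (proj₂ (ψ∈ (valid-tail valid) i))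
      Goal : ℝ → Maybe ℕ → Set
      Goal x b = x + totalLoss i as h ≤ sum {K} (λ k → slotLoss i (toℕ k) (b ∷ s) (e ∷ h))
      finish : ∀ b {x} → x ≤ sum {K} (λ k → when (slot? b (toℕ k)) g) →
               (∀ {k} → just k ∈ s → k ℕ.< K) → Assigned i as s h → Goal x b
      finish b x≤ bounded assigned = ≤-trans
        (+-mono-≤ x≤ (totalLoss≤ i (valid-tail valid) assigned K bounded))
        (≤-reflexive (sym (∑-distrib-+ {K} _ _)))
      go : ∀ {a b} → Assigned i (a ∷ as) (b ∷ s) (e ∷ h) →
           (∀ {k} → just k ∈ b ∷ s → k ℕ.< K) → Goal (when (chosen? a i) g) b
      go {a} (none a≢ assigned) bounded = subst (λ x → Goal x nothing) (sym (when-no (chosen? a i) a≢))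
        (finish nothing (sum-nonNeg {K} (λ k → 0≤when (slot? nothing (toℕ k)) 0≤g))
          (bounded ∘ there) assigned)
      go (sale k assigned _ _) bounded = subst (λ x → Goal x (just k))
        (sym (when-yes (chosen? (just i) i) refl))
        (finish (just k)
          (≤-trans
            (≤-reflexive (sym (when-yes (slot? (just k) (toℕ k′))
              (cong just (sym (Fin.toℕ-fromℕ< k<K))))))
            (term≤sum {K} {λ k′ → when (slot? (just k) (toℕ k′)) g}
              (λ k′ → 0≤when (slot? (just k) (toℕ k′)) 0≤g) k′))
          (bounded ∘ there) assigned)
        where
        k<K : k ℕ.< K
        k<K = bounded (here refl)
        k′ : Fin K
        k′ = fromℕ< k<K

    -- A sale from batch `j` gives each slot of the batch the fraction 1/`slots i j` of its gain. At
    -- most `slots i j` of the numbers below `K` lie in that batch, so no more than the whole gain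
    -- is handed out.
    earned-share : ∀ i K {h} → Valid h →
      sum {K} (λ k → fromℕ (slots i (batchOf i (toℕ k))) ⁻¹ * earned i (batchOf i (toℕ k)) h)
        ≤ totalEarned i h
    earned-share i K {[]} valid = ≤-reflexive (sum-zero {K} _ λ _ → zeroʳ _)
    earned-share i K {e ∷ h} valid = ≤-trans
      (≤-reflexive (trans
        (sum-cong-≗ {K} λ k → distribˡ (m (batchOf i (toℕ k)) ⁻¹) _ _)
        (∑-distrib-+ {K} _ _)))
      (+-mono-≤ (head-share e) (earned-share i K (valid-tail valid)))
      where
      m : ℕ → ℝ
      m j = fromℕ (slots i j)
      g : ℝ
      g = gain h i
      m≢0 : ∀ j → m j ≢ 0#
      m≢0 j = fromℕ≢0 (1≤slots i j)
      share : Maybe (Fin n × ℕ) → ℕ → ℝ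
      share e j = m j ⁻¹ * when (sale? i j e) g
      foreign : ∀ {e} → (∀ {j} → e ≢ just (i , j)) → sum {K} (λ k → share e (batchOf i (toℕ k))) ≡ 0#
      foreign {e} e≢ = sum-zero {K} _ λ k →
        trans (cong (m (batchOf i (toℕ k)) ⁻¹ *_) (when-no (sale? i (batchOf i (toℕ k)) e) e≢)) (zeroʳ _)
      own : ∀ j k → share (just (i , j)) (batchOf i k) ≡ when (batchOf i k ℕ.≟ j) (m j ⁻¹ * g)
      own j k = go (batchOf i k ℕ.≟ j)
        where
        go : ∀ {l} (d : Dec (l ≡ j)) → share (just (i , j)) l ≡ when d (m j ⁻¹ * g)
        go (yes refl) = cong (m j ⁻¹ *_) (when-yes (sale? i j (just (i , j))) refl)
        go {l} (no l≢j) = trans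
          (cong (m l ⁻¹ *_) (when-no (sale? i l (just (i , j))) λ { refl → l≢j refl })) (zeroʳ _)
      by-owner : ∀ {i′} j → Dec (i′ ≡ i) →
        sum {K} (λ k → share (just (i′ , j)) (batchOf i (toℕ k))) ≤ when (chosen? (just i′) i) g
      by-owner {i′} j (no i′≢i) = ≤-trans
        (≤-reflexive (foreign {just (i′ , j)} λ { refl → i′≢i refl }))
        (0≤when (chosen? (just i′) i) (0≤gain (valid-tail valid) i))
      by-owner j (yes refl) = ≤-trans
        (≤-reflexive (sum-cong-≗ {K} λ k → own j (toℕ k)))
        (≤-trans
          (sum-when-interval {K} (firstSlot i j) (slots i j) (λ k → batchOf i k ℕ.≟ j) (batchOf-slots i)
            (0≤⁻¹ (0≤fromℕ (slots i j)) (m≢0 j) ⊛ 0≤gain (valid-tail valid) i))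
          (≤-reflexive (trans
            (solve 3 (λ m z g → m :* (z :* g) := (m :* z) :* g) refl (m j) (m j ⁻¹) g)
            (trans (cong (_* g) (*-inverseʳ (m j) (m≢0 j)))
              (trans (*-identityˡ g) (sym (when-yes (chosen? (just i) i) refl)))))))
      head-share : ∀ e → sum {K} (λ k → share e (batchOf i (toℕ k)))
                   ≤ when (chosen? (Maybe.map proj₁ e) i) g
      head-share nothing        =
        ≤-reflexive (trans (foreign {nothing} λ ())
          (sym (when-no (chosen? nothing i) {g} λ ())))
      head-share (just (i′ , j)) = by-owner j (i′ Fin.≟ i)

    balance : Fin n → History → BatchHistory → ℝ
    balance i as h = totalEarned i h - Γ * totalLoss i as h

    -- The pathwise inequality: `slot-bound` divided by the number of slots says that the loss in a
    -- slot is covered by the slot's share of its batch's gains, and the shares are summed over all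
    -- slots in use.
    0≤balance : ∀ i {as s h} → Valid h → Assigned i as s h → 0# ≤ balance i as h
    0≤balance i {as} {s} {h} valid assigned = gap (≤-trans
      (*-monoˡ-≤ 0≤G (totalLoss≤ i valid assigned K bounded))
      (≤-trans
        (≤-reflexive (*-distribˡ-sum {K} Γ _))
        (≤-trans (sum-mono {K} λ k → per-slot (toℕ k)) (earned-share i K valid))))
      where
      K : ℕ
      K = proj₁ (slots-bounded s)
      bounded : ∀ {k} → just k ∈ s → k ℕ.< K
      bounded = proj₂ (slots-bounded s)
      per-slot : ∀ k → Γ * slotLoss i k s h ≤ fromℕ (slots i (batchOf i k)) ⁻¹ * earned i (batchOf i k) h
      per-slot k = ≤-trans
        (≤-reflexive (trans (sym (*-identityˡ _)) (trans (cong (_* (Γ * L)) (sym (*-inverseʳ m m≢0)))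
          (solve 3 (λ m z x → (m :* z) :* x := z :* (m :* x :+ :0)) refl m (m ⁻¹) (Γ * L)))))
        (*-monoˡ-≤ (0≤⁻¹ (0≤fromℕ (slots i (batchOf i k))) m≢0)
          (slot-bound i k valid assigned zero λ ()))
        where
        m L : ℝ
        m = fromℕ (slots i (batchOf i k))
        L = slotLoss i k s h
        m≢0 : m ≢ 0#
        m≢0 = fromℕ≢0 (1≤slots i (batchOf i k))

    -- Existence of a free slot in a ready batch.

    addUnit-invariant : ∀ k {e c} → c ℕ.< γ →
      let B = iterate addUnit (batches e c) k in
      Batches.extra B ℕ.* γ ℕ.+ Batches.charging B ≡ e ℕ.* γ ℕ.+ (c ℕ.+ k) × Batches.charging B ℕ.< γ
    addUnit-invariant zero {e} {c} c<γ = cong (e ℕ.* γ ℕ.+_) (sym (ℕ.+-identityʳ c)) , c<γ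
    addUnit-invariant (suc k) {e} {c} c<γ with suc c ℕ.≟ γ
    ... | yes refl = trans (proj₁ ih) eq , proj₂ ih
      where
      ih = addUnit-invariant k {suc e} {0} 1≤γ
      eq : suc e ℕ.* suc c ℕ.+ k ≡ e ℕ.* suc c ℕ.+ (c ℕ.+ suc k)
      eq = trans (cong (ℕ._+ k) (ℕ.+-comm (suc c) (e ℕ.* suc c)))
             (trans (ℕ.+-assoc (e ℕ.* suc c) (suc c) k) (cong (e ℕ.* suc c ℕ.+_) (sym (ℕ.+-suc c k))))
    ... | no c≢ = trans (proj₁ ih) (cong (e ℕ.* γ ℕ.+_) (sym (ℕ.+-suc c k))) , proj₂ ih
      where
      ih = addUnit-invariant k {e} {suc c} (ℕ.≤∧≢⇒< c<γ c≢)

    -- The benchmark may sell units that BIB still holds in the charging batch. There are fewer than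
    -- γ of these, and the ready batches together have γ more slots than units, so numbering all
    -- units present never leaves the ready batches.
    batchOf-ready : ∀ i t {k} → k ℕ.< inventory i ℕ.+ arrived i (suc t) → batchOf i k ℕ.< ready i t
    batchOf-ready i t {k} k< = ℕ.m<n*o⇒m/o<n {n = ready i t} (ℕ.≤-<-trans
      (ℕ.m≤n+o⇒m∸n≤o k (inventory i) (ℕ.<⇒≤ k<))
      (subst₂ ℕ._<_ (proj₁ invariant) (ℕ.+-comm _ γ)
        (ℕ.+-monoʳ-< (Batches.extra B ℕ.* γ) (proj₂ invariant))))
      where
      B : Batches
      B = batchesAt i t
      invariant : Batches.extra B ℕ.* γ ℕ.+ Batches.charging B ≡ arrived i (suc t)
                  × Batches.charging B ℕ.< γ
      invariant = addUnit-invariant (arrived i (suc t)) {0} {0} 1≤γ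

    occupied : ∀ i {as s h} → Assigned i as s h → ∀ m →
      length (catMaybes (take m s)) ≡ count (λ a → chosen? a i) (take m as)
    occupied i assigned zero = refl
    occupied i [] (suc m) = refl
    occupied i (none a≢ assigned) (suc m) =
      trans (occupied i assigned m) (sym (count-reject (λ a → chosen? a i) a≢))
    occupied i (sale k assigned _ _) (suc m) =
      trans (cong suc (occupied i assigned m)) (sym (count-accept (λ a → chosen? a i) refl))

    -- The slots occupied during the last window are as many as the benchmark's units away. `free`
    -- therefore yields a number at most that count, which availability puts below the number of
    -- units present, and `batchOf-ready` applies.
    extend : ∀ i {as s h} → Assigned i as s h → length as ≡ length h → ∀ a e →
             (a ≡ just i → Available as i) → ∃[ s′ ] Assigned i (a ∷ as) s′ (e ∷ h)
    extend i {as} {s} {h} assigned len a e available with chosen? a i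
    ... | no a≢    = nothing ∷ s , none a≢ assigned
    ... | yes refl = just k ∷ s , sale k assigned (proj₂ (proj₂ slot) ∘ just∈⇒∈-catMaybes)
        (subst (λ t → batchOf i k ℕ.< ready i t) len (batchOf-ready i (length as)
          (ℕ.≤-<-trans (ℕ.≤-trans (proj₁ (proj₂ slot)) (ℕ.≤-reflexive (occupied i assigned (window i))))
            (available refl))))
      where
      slot = free (catMaybes (take (window i) s))
      k : ℕ
      k = proj₁ slot

    -- The potential of a pair of paths.

    record Coupled (as : History) (h : BatchHistory) : Set where
      field
        same-length : length as ≡ length h
        valid       : Valid h
        assignment  : ∀ i → ∃[ s ] Assigned i as s h

    -- The surplus of past gains over Γ times past losses, weighted by price. Added to BIB's future
    -- revenue it gives a claim about arbitrary coupled histories that can be proved by induction on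
    -- the remaining periods: it is 0 at the start and nonnegative at the end.
    potential : History → BatchHistory → ℝ
    potential as h = sum (λ i → price i * balance i as h)

    0≤potential : ∀ {as h} → Coupled as h → 0# ≤ potential as h
    0≤potential coupled = sum-nonNeg λ i →
      price-nonNeg i ⊛ 0≤balance i (Coupled.valid coupled) (proj₂ (Coupled.assignment coupled i))

    at : (Fin n → ℝ) → Maybe (Fin n) → ℝ
    at f (just i) = f i
    at f nothing  = 0#

    sum-when-chosen : ∀ (f g : Fin n → ℝ) a →
      sum (λ i → f i * when (chosen? a i) (g i)) ≡ at (λ i → f i * g i) a
    sum-when-chosen f g nothing = sum-zero {n} _ λ i →
      trans (cong (f i *_) (when-no (chosen? nothing i) {g i} λ ())) (zeroʳ _)
    sum-when-chosen f g (just i) = trans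
      (sum-single _ i λ j j≢i →
        trans (cong (f j *_) (when-no (chosen? (just i) j) λ { refl → j≢i refl })) (zeroʳ _))
      (cong (f i *_) (when-yes (chosen? (just i) i) refl))

    earning : BatchHistory → Maybe (Fin n) → ℝ
    earning h = at (λ i → price i * gain h i)

    losing : BatchHistory → Maybe (Fin n) → ℝ
    losing h = at (λ i → price i * (1# - ψ h i))

    potential-∷ : ∀ a as e h →
      potential (a ∷ as) (e ∷ h) ≡ earning h (Maybe.map proj₁ e) - Γ * losing h a + potential as h
    potential-∷ a as e h = begin
      sum (λ i → price i * balance i (a ∷ as) (e ∷ h))
        ≡⟨ sum-cong-≗ {n} (λ i → solve 6 (λ r x y G l L → r :* ((x :+ y) :- G :* (l :+ L))
             := (r :* x :+ (:0 :- G) :* (r :* l)) :+ r :* (y :- G :* L)) refl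
             (price i) (E i) (totalEarned i h) Γ (L i) (totalLoss i as h)) ⟩
      sum (λ i → (price i * E i + (0# - Γ) * (price i * L i)) + price i * balance i as h)
        ≡⟨ ∑-distrib-+ {n} _ _ ⟩
      sum (λ i → price i * E i + (0# - Γ) * (price i * L i)) + potential as h
        ≡⟨ cong (_+ potential as h) (∑-distrib-+ {n} _ _) ⟩
      sum (λ i → price i * E i) + sum (λ i → (0# - Γ) * (price i * L i)) + potential as h
        ≡⟨ cong (λ z → sum (λ i → price i * E i) + z + potential as h) (*-distribˡ-sum {n} (0# - Γ) _) ⟨
      sum (λ i → price i * E i) + (0# - Γ) * sum (λ i → price i * L i) + potential as h
        ≡⟨ cong₂ (λ y z → y + (0# - Γ) * z + potential as h)
             (sum-when-chosen price (gain h) (Maybe.map proj₁ e))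
             (sum-when-chosen price (λ i → 1# - ψ h i) a) ⟩
      earning h (Maybe.map proj₁ e) + (0# - Γ) * losing h a + potential as h
        ≡⟨ solve 4 (λ x G y z → x :+ (:0 :- G) :* y :+ z := x :- G :* y :+ z) refl
             (earning h (Maybe.map proj₁ e)) Γ (losing h a) (potential as h) ⟩
      earning h (Maybe.map proj₁ e) - Γ * losing h a + potential as h ∎
      where
      open ≡-Reasoning
      E L : Fin n → ℝ
      E i = when (chosen? (Maybe.map proj₁ e) i) (gain h i)
      L i = when (chosen? a i) (1# - ψ h i)

    -- Expectations over one consumer's choice, and the offered assortments.

    expectation : (Fin n → ℝ) → (Maybe (Fin n) → ℝ) → ℝ
    expectation p X = sum (λ i → p i * X (just i)) + (1# - sum p) * X nothing

    expectation-+ : ∀ p X Y → expectation p (λ a → X a + Y a) ≡ expectation p X + expectation p Y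
    expectation-+ p X Y = trans
      (cong (_+ (1# - sum p) * (X nothing + Y nothing)) (trans
        (sum-cong-≗ {n} λ i → distribˡ (p i) _ _) (∑-distrib-+ {n} _ _)))
      (solve 5 (λ a b s x y → (a :+ b) :+ (:1 :- s) :* (x :+ y)
          := (a :+ (:1 :- s) :* x) :+ (b :+ (:1 :- s) :* y))
        refl _ _ (sum p) (X nothing) (Y nothing))

    expectation-* : ∀ p c X → expectation p (λ a → c * X a) ≡ c * expectation p X
    expectation-* p c X = trans
      (cong (_+ (1# - sum p) * (c * X nothing)) (trans
        (sum-cong-≗ {n} λ i → solve 3 (λ p c x → p :* (c :* x) := c :* (p :* x))
          refl (p i) c (X (just i)))
        (sym (*-distribˡ-sum {n} c _))))
      (solve 4 (λ c a s x → c :* a :+ (:1 :- s) :* (c :* x) := c :* (a :+ (:1 :- s) :* x))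
        refl c _ (sum p) (X nothing))

    expectation-const : ∀ p c → expectation p (λ _ → c) ≡ c
    expectation-const p c = trans
      (cong (_+ (1# - sum p) * c) (trans
        (sum-cong-≗ {n} λ i → *-comm (p i) c) (sym (*-distribˡ-sum {n} c p))))
      (solve 2 (λ c s → c :* s :+ (:1 :- s) :* c := c) refl c (sum p))

    expectation-at : ∀ p f → expectation p (at f) ≡ sum (λ i → p i * f i)
    expectation-at p f = trans (cong (sum (λ i → p i * f i) +_) (zeroʳ _)) (+-identityʳ _)

    -- Products outside `S` have probability 0, so the pointwise bound is asked only where
    -- availability is known.
    expectation-mono : ∀ t {S} → Feasible S → ∀ {X Y} →
      (∀ i → i ∈ₛ S → X (just i) ≤ Y (just i)) → X nothing ≤ Y nothing →
      expectation (probAt t S) X ≤ expectation (probAt t S) Y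
    expectation-mono t {S} feasible {X} {Y} X≤Y X≤Y₀ = +-mono-≤
      (sum-mono λ i → by-membership i (i Subset.∈? S))
      (*-monoˡ-≤ (gap (ChoiceModel.prob-total (φ t) feasible)) X≤Y₀)
      where
      p : Fin n → ℝ
      p = probAt t S
      by-membership : ∀ i → Dec (i ∈ₛ S) → p i * X (just i) ≤ p i * Y (just i)
      by-membership i (yes i∈) = *-monoˡ-≤ (ChoiceModel.prob-nonNeg (φ t) feasible i) (X≤Y i i∈)
      by-membership i (no i∉)  = ≤-reflexive (trans (vanish (X (just i))) (sym (vanish (Y (just i)))))
        where
        vanish : ∀ x → p i * x ≡ 0#
        vanish x = trans (cong (_* x) (ChoiceModel.prob-support (φ t) feasible i∉)) (zeroˡ x)

    revenueFrom-suc : ∀ π k h → let p = probAt (length h) (π h) in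
      revenueFrom π (suc k) h ≡ sum (λ i → p i * price i) + expectation p (λ a → revenueFrom π k (a ∷ h))
    revenueFrom-suc π k h = trans
      (cong (_+ (1# - sum p) * R nothing) (trans
        (sum-cong-≗ {n} λ i → distribˡ (p i) (price i) (R (just i))) (∑-distrib-+ {n} _ _)))
      (solve 3 (λ a b c → (a :+ b) :+ c := a :+ (b :+ c)) refl _ _ _)
      where
      p : Fin n → ℝ
      p = probAt (length h) (π h)
      R : Maybe (Fin n) → ℝ
      R a = revenueFrom π k (a ∷ h)

    -- Deleting a product of weight 0 does not decrease the value, by weak
    -- substitutability, but decreases the cardinality.
    weight≢0 : ∀ t {R̂ S} → (∀ i → 0# ≤ R̂ i) → ChoiceModel.IsSmallestMaximizer (φ t) R̂ S →
               ∀ {i} → i ∈ₛ S → R̂ i ≢ 0#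
    weight≢0 t {R̂} {S} 0≤R̂ smallest-maximizer {i} i∈S R̂≡0 =
      ℕ.<⇒≱ (Subset.x∈p⇒∣p-x∣<∣p∣ i∈S) (smallest feasible′ (antisym (maximal feasible′) value≤))
      where
      open ChoiceModel (φ t)
      open IsSmallestMaximizer smallest-maximizer
      S′ : Subset n
      S′ = S Subset.- i
      feasible′ : Feasible S′
      feasible′ = downward-closed feasible (Subset.p─q⊆p S ⁅ i ⁆)
      restore : S′ ∪ ⁅ i ⁆ ≡ S
      restore = Subset.⊆-antisym
        (λ x∈ → [ Subset.p─q⊆p S ⁅ i ⁆ , (λ x∈i → subst (_∈ₛ S) (sym (Subset.x∈⁅y⁆⇒x≡y i x∈i)) i∈S) ]′
          (Subset.x∈p∪q⁻ S′ ⁅ i ⁆ x∈))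
        (λ {x} x∈ → Subset.x∈p∪q⁺ (back x∈ (x Fin.≟ i)))
        where
        back : ∀ {x} → x ∈ₛ S → Dec (x ≡ i) → x ∈ₛ S′ ⊎ x ∈ₛ ⁅ i ⁆
        back x∈ (yes refl) = inj₂ (Subset.x∈⁅x⁆ i)
        back x∈ (no x≢i)   = inj₁ (Subset.x∈p∧x≢y⇒x∈p-y x∈ x≢i)
      value≤ : value R̂ S ≤ value R̂ S′
      value≤ = sum-mono λ j → term j (j Fin.≟ i)
        where
        term : ∀ j → Dec (j ≡ i) → R̂ j * prob S j ≤ R̂ j * prob S′ j
        term j (yes refl) = ≤-reflexive (trans (trans (cong (_* prob S i) R̂≡0) (zeroˡ _))
          (sym (trans (cong (_* prob S′ i) R̂≡0) (zeroˡ _))))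
        term j (no j≢i) = *-monoˡ-≤ (0≤R̂ j)
          (subst (λ z → prob z j ≤ prob S′ j) restore
            (substitutable (j≢i ∘ sym) feasible′ (subst Feasible (sym restore) feasible)))

    length-allocate : ∀ bs → length (allocate bs) ≡ length bs
    length-allocate []             = refl
    length-allocate (nothing ∷ bs) = cong suc (length-allocate bs)
    length-allocate (just i ∷ bs)  = cong suc (length-allocate bs)

    weights : BatchHistory → Vector ℝ n
    weights h i = price i * ψ h i

    earning-weights : ∀ h (p : Fin n → ℝ) → sum (λ i → p i * (price i * gain h i)) ≡
      sum (λ i → p i * price i) - Γ * sum (λ i → weights h i * p i)
    earning-weights h p = trans
      (sum-cong-≗ {n} λ i → solve 4 (λ p r G x → p :* (r :* (:1 :- G :* x))
          := p :* r :+ (:- G) :* ((r :* x) :* p))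
        refl (p i) (price i) Γ (ψ h i))
      (trans (∑-distrib-+ {n} (λ i → p i * price i) (λ i → - Γ * (weights h i * p i)))
        (trans (cong (sum (λ i → p i * price i) +_)
          (sym (*-distribˡ-sum {n} (- Γ) (λ i → weights h i * p i))))
          (solve 3 (λ a G b → a :+ (:- G) :* b := a :- G :* b) refl
            (sum λ i → p i * price i) Γ (sum λ i → weights h i * p i))))

    losing-weights : ∀ h (p : Fin n → ℝ) → sum (λ i → p i * (price i * (1# - ψ h i))) ≡
      sum (λ i → p i * price i) - sum (λ i → weights h i * p i)
    losing-weights h p = trans
      (sum-cong-≗ {n} λ i → solve 3 (λ p r x → p :* (r :* (:1 :- x))
          := p :* r :+ (:- :1) :* ((r :* x) :* p))
        refl (p i) (price i) (ψ h i))
      (trans (∑-distrib-+ {n} (λ i → p i * price i) (λ i → - 1# * (weights h i * p i)))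
        (trans (cong (sum (λ i → p i * price i) +_)
          (sym (*-distribˡ-sum {n} (- 1#) (λ i → weights h i * p i))))
          (solve 2 (λ a b → a :+ (:- :1) :* b := a :- b) refl
            (sum λ i → p i * price i) (sum λ i → weights h i * p i))))

    module _ {h : BatchHistory} (valid : Valid h) where
      0≤weights : ∀ i → 0# ≤ weights h i
      0≤weights i = price-nonNeg i ⊛ proj₁ (ψ∈ valid i)

      offer-maximizer : ChoiceModel.IsSmallestMaximizer (φ (length h)) (weights h) (offer h)
      offer-maximizer = exact (length h) (weights h) 0≤weights

      -- If all units of the fullest ready batch were away, `top` would be 0 and the weight of the
      -- product `price i * Ψ 0# = 0`, which `weight≢0` excludes for offered products.
      offered-available : ∀ {i} → i ∈ₛ offer h →
        awayFrom i (toℕ (rule h i)) h ℕ.< batchSize i (toℕ (rule h i))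
      offered-available {i} i∈ = ℕ.≤∧≢⇒< (awayFrom≤batchSize valid i j) λ eq →
        weight≢0 (length h) 0≤weights offer-maximizer i∈
          (trans (cong (λ z → price i * Ψ z) (trans (top≡ h i)
            (trans (cong (point i j) eq) (Grid.point-b (batchSize i j) (1≤batchSize i j)))))
            (trans (cong (price i *_) at-0) (zeroʳ _)))
        where
        j : ℕ
        j = toℕ (rule h i)

    -- The benchmark and BIB make their choices independently; the step uses
    -- that BIB offers an assortment of maximal weight.
    revenue-comparison : ∀ π k as bs → Coupled as (allocate bs) → FeasibleFrom π k as →
      Γ * revenueFrom π k as ≤ revenueFrom BIB k bs + potential as (allocate bs)
    revenue-comparison π zero as bs coupled feasible = ≤-trans
      (≤-reflexive (zeroʳ Γ)) (≤-trans (0≤potential coupled) (≤-reflexive (sym (+-identityˡ _))))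
    revenue-comparison π (suc k) as bs coupled (feasible , available , feasible-just , feasible-nothing) =
      subst₂ (λ x y → Γ * x ≤ y + Φ) (sym revenue-π) (sym revenue-BIB)
        -- Maximality is applied to the benchmark's assortment. BIB may lack the stock for it, but
        -- the oracle ranges over all feasible assortments regardless of stock.
        (certify (gap averaged ⊹ 0≤G ⊛ gap (maximal feasible))
          (solve 8 (λ G v w a b x y f → b :+ w :+ f := G :* (a :+ v) :+
              ((w :+ (b :- G :* y) :+ f :- (G :* v :+ G :* (a :- x))) :+ G :* (y :- x)))
            refl Γ (expectation p V) (expectation q W)
              (sum (λ i → p i * price i)) (sum (λ i → q i * price i))
              (sum (λ i → weights h i * p i)) (sum (λ i → weights h i * q i)) Φ))
      where
      h : BatchHistory
      h = allocate bs
      open Coupled coupled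
      open ChoiceModel.IsSmallestMaximizer (offer-maximizer valid)
        using (maximal) renaming (feasible to offer-feasible)
      t : ℕ
      t = length h
      p q : Fin n → ℝ
      p = probAt t (π as)
      q = probAt t (offer h)
      V W : Maybe (Fin n) → ℝ
      V a = revenueFrom π k (a ∷ as)
      W b = revenueFrom BIB k (b ∷ bs)
      Φ : ℝ
      Φ = potential as h

      revenue-π : revenueFrom π (suc k) as ≡ sum (λ i → p i * price i) + expectation p V
      revenue-π = trans (revenueFrom-suc π k as)
        (cong (λ t → sum (λ i → probAt t (π as) i * price i) + expectation (probAt t (π as)) V)
          same-length)

      revenue-BIB : revenueFrom BIB (suc k) bs ≡ sum (λ i → q i * price i) + expectation q W
      revenue-BIB = trans (revenueFrom-suc BIB k bs)
        (cong (λ t → sum (λ i → probAt t (offer h) i * price i) + expectation (probAt t (offer h)) W)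
          (sym (length-allocate bs)))

      next : ∀ a e → (∀ i → a ≡ just i → Available as i) → Valid (e ∷ h) → Coupled (a ∷ as) (e ∷ h)
      next a e available valid′ = record
        { same-length = cong suc same-length
        ; valid       = valid′
        ; assignment  = λ i → extend i (proj₂ (assignment i)) same-length a e (available i)
        }

      -- The benchmark's choice `a` is held fixed while the induction hypothesis is averaged over
      -- BIB's choice; `averaged` then averages over `a`.
      pointwise : ∀ a → (∀ i → a ≡ just i → Available as i) → FeasibleFrom π k (a ∷ as) →
        Γ * V a + Γ * losing h a ≤ expectation q (λ b → W b + earning h b + Φ)
      pointwise a available feasible′ = subst
        (_≤ expectation q (λ b → W b + earning h b + Φ))
        (expectation-const q (Γ * V a + Γ * losing h a))
        (expectation-mono t offer-feasible
          {λ _ → Γ * V a + Γ * losing h a} {λ b → W b + earning h b + Φ}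
          (λ i i∈ → rearrange (just i) (just (i , toℕ (rule h i))) refl
            (revenue-comparison π k (a ∷ as) (just i ∷ bs)
              (next a _ available (sale i valid (offered-available valid i∈))) feasible′))
          (rearrange nothing nothing refl
            (revenue-comparison π k (a ∷ as) (nothing ∷ bs)
              (next a _ available (none valid)) feasible′)))
        where
        rearrange : ∀ b e → Maybe.map proj₁ e ≡ b →
          Γ * V a ≤ W b + potential (a ∷ as) (e ∷ h) →
          Γ * V a + Γ * losing h a ≤ W b + earning h b + Φ
        rearrange b e refl bound = certify
          (gap (subst (λ z → Γ * V a ≤ W b + z) (potential-∷ a as e h) bound))
          (solve 6 (λ G v l w x f → w :+ x :+ f
              := (G :* v :+ G :* l) :+ ((w :+ (x :- G :* l :+ f)) :- G :* v))
            refl Γ (V a) (losing h a) (W b) (earning h b) Φ)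

      averaged : Γ * expectation p V + Γ * (sum (λ i → p i * price i) - sum (λ i → weights h i * p i))
        ≤ expectation q W + (sum (λ i → q i * price i) - Γ * sum (λ i → weights h i * q i)) + Φ
      averaged = subst₂ _≤_
        (trans (expectation-+ p (λ a → Γ * V a) (λ a → Γ * losing h a))
          (cong₂ _+_ (expectation-* p Γ V)
            (trans (expectation-* p Γ (losing h))
              (cong (Γ *_) (trans (expectation-at p (λ i → price i * (1# - ψ h i)))
                (losing-weights h p))))))
        (trans (expectation-const p (expectation q (λ b → W b + earning h b + Φ)))
          (trans (expectation-+ q (λ b → W b + earning h b) (λ _ → Φ))
            (cong₂ _+_
              (trans (expectation-+ q W (earning h))
                (cong (expectation q W +_)
                  (trans (expectation-at q (λ i → price i * gain h i)) (earning-weights h q))))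
              (expectation-const q Φ))))
        (expectation-mono t feasible
          {λ a → Γ * V a + Γ * losing h a} {λ _ → expectation q (λ b → W b + earning h b + Φ)}
          (λ i i∈ → pointwise (just i) (λ { j refl → available j i∈ }) (feasible-just i i∈))
          (pointwise nothing (λ _ ()) feasible-nothing))

    bound : ∀ π {T} → FeasibleFrom π T [] → Γ * revenue π T ≤ revenue BIB T
    bound π {T} feasible = ≤-trans
      (revenue-comparison π T [] [] initial feasible)
      (≤-reflexive (trans (cong (revenue BIB T +_) initial-potential) (+-identityʳ _)))
      where
      initial : Coupled [] []
      initial = record { same-length = refl ; valid = [] ; assignment = λ i → [] , [] }
      initial-potential : potential [] [] ≡ 0#
      initial-potential = sum-zero {n} _ λ i →
        solve 2 (λ r G → r :* (:0 :- G :* :0) := :0) refl (price i) Γ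

    -- From single policies to the supremum over all of them.

    idle : Policy
    idle _ = Subset.⊥

    idle-feasible : ∀ k h → FeasibleFrom idle k h
    idle-feasible zero    h = tt
    idle-feasible (suc k) h =
      downward-closed (proj₂ nonempty) Subset.⊥⊆ ,
      (λ i i∈ → contradiction i∈ Subset.∉⊥) ,
      (λ i i∈ → contradiction i∈ Subset.∉⊥) ,
      idle-feasible k (nothing ∷ h)

    -- `sup-least` needs a bound free of Γ on the left, so `bound` is divided by Γ. If Γ is 0, the
    -- left side equals Γ times the revenue of `idle`. The same policy shows that the set behind
    -- `OPT` is inhabited.
    competitive : ∀ T → Γ * OPT T ≤ revenue BIB T
    competitive T with Γ ≟ 0#
    ... | yes Γ≡0 = subst (_≤ revenue BIB T)
      (trans (vanish (revenue idle T)) (sym (vanish (OPT T)))) (bound idle (idle-feasible T []))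
      where
      vanish : ∀ x → Γ * x ≡ 0#
      vanish x = trans (cong (_* x) Γ≡0) (zeroˡ x)
    ... | no Γ≢0 = subst (Γ * OPT T ≤_) (cancel (revenue BIB T)) (*-monoˡ-≤ 0≤G
      (sup-least _ (_ , idle , idle-feasible T [] , refl) (_ , below) below))
      where
      cancel : ∀ x → Γ * (Γ ⁻¹ * x) ≡ x
      cancel x = trans (solve 3 (λ G z x → G :* (z :* x) := (G :* z) :* x) refl Γ (Γ ⁻¹) x)
        (trans (cong (_* x) (*-inverseʳ Γ Γ≢0)) (*-identityˡ x))
      below : ∀ {v} → ∃[ π ] (FeasibleFrom π T [] × v ≡ revenue π T) → v ≤ Γ ⁻¹ * revenue BIB T
      below (π , feasible , refl) = subst (_≤ Γ ⁻¹ * revenue BIB T)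
        (trans (solve 3 (λ G z x → z :* (G :* x) := G :* (z :* x)) refl Γ (Γ ⁻¹) (revenue π T))
          (cancel (revenue π T)))
        (*-monoˡ-≤ (0≤⁻¹ 0≤G Γ≢0) (bound π feasible))

theorem1 : (F : CompleteOrderedField) → let open Assortment F in
    (n : ℕ) .{{_ : NonZero n}} (products : Products n) (𝒮 : Assortments n) →
    (Ψ : ℝ → ℝ) → IsPenalty Ψ →
    let c₀ = Products.minInventory products in
    (γ : ℕ) → 1 ℕ.≤ γ → γ ℕ.≤ c₀ →
    (T : ℕ) → 1 ℕ.≤ T →
    (φ : ℕ → ChoiceModel 𝒮) (ξ : ℕ → Fin n → ℕ) →
    let open Market products 𝒮 φ ξ
        open Batching γ in
    (oracle : Oracle) → IsExactOracle oracle →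
    (rule : BatchRule) → SelectsFullest rule →
    let open Algorithm Ψ oracle rule in
    Bound.Γ Ψ γ c₀ * OPT T ≤ revenue BIB T
theorem1 F n products 𝒮 Ψ isPenalty γ 1≤γ _ T _ φ ξ oracle exact rule fullest =
  Comparison.Run.competitive F products 𝒮 φ ξ Ψ isPenalty γ minInventory 1≤γ
    (foldr₁-preserves (1 ℕ.≤_) ℕ.⊓-glb inventory inventory-positive)
    (foldr₁-dominates (flip ℕ._≤_) ℕ.≤-refl (flip ℕ.≤-trans) ℕ.m⊓n≤m ℕ.m⊓n≤n inventory)
    oracle exact rule fullest T
  where open Assortment.Products products
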